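{- For relations $R_1,R_2,R_3\in\{\leq,\geq,<,>,=,\neq,-\}$ let $I_{(R_1,R_2,R_3)}(z,t)=\sum_{n\ge0}\sum_{e\in\mathbf{I}_n(R_1,R_2,R_3)}z^nt^{\mathrm{dist}(e)}$. Then $$I_{(<,-,<)}(z,t)=\frac{1-3z+zt+3z^2-2z^2t+z^2t^2-z^3+z^3t}{(1-z)^3},$$ $$I_{(\neq,<,-)}(z,t)=\frac{1-4z+zt+6z^2-4z^2t+z^2t^2-4z^3+5z^3t-z^3t^2+z^4-2z^4t+z^4t^2}{(1-z)^2(1-2z+z^2-z^2t)},$$ $$I_{(\neq,\leq,-)}(z,t)=\frac{1-2z+zt+z^2-2z^2t+z^2t^2+z^3t}{(1-z)(1-z-z^2t)},$$ $$I_{(>,<,-)}(z,t)=\frac{1+z(2-t)-z^2(1-t)-(1-z)\sqrt{(1+z-zt)^2-\frac{4z(1-z+zt)}{1-z}}}{2z(2-z)},$$ $$I_{(>,\leq,-)}(z,t)=\frac{1+z(3-t)-\sqrt{1-z(2+2t-z+6zt-zt^2)}}{4z},$$ $$I_{(>,\neq,-)}(z,t)=\frac{1-2z+z^2(1-t)^2+(1-z+zt)\sqrt{(1+z-zt)^2-4z}}{2(1-z)\sqrt{(1+z-zt)^2-4z}},$$ $$I_{(\geq,\neq,-)}(z,t)=\frac{1-z-zt+2z^2t}{(1-z)(1-zt)^2},\qquad I_{(=,<,-)}(z,t)=\frac{1-z}{1-z-zt},$$ $$I_{(=,\leq,-)}(z,t)=\frac{1}{1-zt-z^2t},\qquad 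I_{(\geq,\leq,\neq)}(z,t)=\frac{1-z+z^3t}{(1-z)(1-zt-z^2t)}.$$
   Context: An inversion sequence of length $n$ is an integer sequence $e=e_1\dots e_n$ with $0\le e_i<i$ for all $i$; $\mathbf{I}_n$ is the set of these, and $\mathbf{I}_0$ consists only of the empty sequence. For a triple of relations $(R_1,R_2,R_3)$ with each $R_i\in\{\leq,\geq,<,>,=,\neq,-\}$, where $-$ is the trivial relation ($x-y$ holds for all $x,y$), $\mathbf{I}_n(R_1,R_2,R_3)$ is the set of $e\in\mathbf{I}_n$ with no indices $i<j<k$ such that $e_iR_1e_j$, $e_jR_2e_k$ and $e_iR_3e_k$. For $e\in\mathbf{I}_n$, $\mathrm{dist}(e)=|\{e_1,\dots,e_n\}|$ is the number of distinct entries. -}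

module Defs where

open import Data.Nat as ℕ using (ℕ; zero; suc; _∸_)
open import Data.Nat.Properties as ℕP using ()
open import Data.Integer as ℤ using (ℤ; +_)
open import Data.Fin as Fin using (Fin)
open import Data.Fin.Properties using (any?)
open import Data.Vec as Vec using (Vec; []; _∷ʳ_; lookup; toList)
open import Data.List as List using (List; _∷_; []; length; filter; map; concatMap; upTo; deduplicate)
open import Data.Product using (_×_; ∃; _,_)
open import Data.Unit using (⊤; tt)
open import Relation.Nullary using (¬_; Dec; yes; no; ¬?)
open import Relation.Nullary.Decidable using (_×-dec_)
open import Relation.Binary.PropositionalEquality using (_≡_)

data Rel : Set where
  ≤r ≥r <r >r =r ≠r -r : Rel

⟦_⟧ : Rel → ℕ → ℕ → Set
⟦ ≤r ⟧ x y = x ℕ.≤ y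
⟦ ≥r ⟧ x y = x ℕ.≥ y
⟦ <r ⟧ x y = x ℕ.< y
⟦ >r ⟧ x y = x ℕ.> y
⟦ =r ⟧ x y = x ≡ y
⟦ ≠r ⟧ x y = ¬ (x ≡ y)
⟦ -r ⟧ x y = ⊤

⟦_⟧? : (R : Rel) → (x y : ℕ) → Dec (⟦ R ⟧ x y)
⟦ ≤r ⟧? x y = x ℕ.≤? y
⟦ ≥r ⟧? x y = y ℕ.≤? x
⟦ <r ⟧? x y = x ℕ.<? y
⟦ >r ⟧? x y = y ℕ.<? x
⟦ =r ⟧? x y = x ℕ.≟ y
⟦ ≠r ⟧? x y = ¬? (x ℕ.≟ y)
⟦ -r ⟧? x y = yes tt

-- Inversion sequences of length n, as vectors e = e₁ … eₙ (position i,
-- 0-based index i-1, carries a value in {0,…,i-1}).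
-- allInv n lists every element of 𝐈ₙ exactly once.

allInv : (n : ℕ) → List (Vec ℕ n)
allInv zero    = [] ∷ []
allInv (suc n) = concatMap (λ e → map (λ v → e ∷ʳ v) (upTo (suc n))) (allInv n)

Occurs : Rel → Rel → Rel → {n : ℕ} → Vec ℕ n → Fin n → Fin n → Fin n → Set
Occurs R₁ R₂ R₃ e i j k =
  (i Fin.< j) × (j Fin.< k) ×
  ⟦ R₁ ⟧ (lookup e i) (lookup e j) × ⟦ R₂ ⟧ (lookup e j) (lookup e k) ×
  ⟦ R₃ ⟧ (lookup e i) (lookup e k)

Contains : Rel → Rel → Rel → {n : ℕ} → Vec ℕ n → Set
Contains R₁ R₂ R₃ e = ∃ λ i → ∃ λ j → ∃ λ k → Occurs R₁ R₂ R₃ e i j k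

contains? : (R₁ R₂ R₃ : Rel) → {n : ℕ} → (e : Vec ℕ n) → Dec (Contains R₁ R₂ R₃ e)
contains? R₁ R₂ R₃ e =
  any? λ i → any? λ j → any? λ k →
    (i Fin.<? j) ×-dec (j Fin.<? k) ×-dec ⟦ R₁ ⟧? (lookup e i) (lookup e j)
    ×-dec ⟦ R₂ ⟧? (lookup e j) (lookup e k) ×-dec ⟦ R₃ ⟧? (lookup e i) (lookup e k)

avoiders : Rel → Rel → Rel → (n : ℕ) → List (Vec ℕ n)
avoiders R₁ R₂ R₃ n = filter (λ e → ¬? (contains? R₁ R₂ R₃ e)) (allInv n)

dist : {n : ℕ} → Vec ℕ n → ℕ
dist e = length (deduplicate ℕ._≟_ (toList e))

-- Formal power series in z and t with integer coefficients:
-- f n k is the coefficient of zⁿ tᵏ.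

Series : Set
Series = ℕ → ℕ → ℤ

_≋_ : Series → Series → Set
f ≋ g = ∀ n k → f n k ≡ g n k
infix 4 _≋_

sumTo : ℕ → (ℕ → ℤ) → ℤ
sumTo zero    f = f 0
sumTo (suc n) f = sumTo n f ℤ.+ f (suc n)

infixl 6 _⊕_ _⊝_
infixl 7 _⊛_
infixr 8 _^ₛ_

_⊕_ : Series → Series → Series
(f ⊕ g) n k = f n k ℤ.+ g n k

_⊝_ : Series → Series → Series
(f ⊝ g) n k = f n k ℤ.- g n k

_⊛_ : Series → Series → Series
(f ⊛ g) n k = sumTo n λ i → sumTo k λ j → f i j ℤ.* g (n ∸ i) (k ∸ j)

cst : ℤ → Series
cst c zero zero = c
cst c _    _    = + 0

# : ℕ → Series
# m = cst (+ m)

z : Series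
z (suc zero) zero = + 1
z _ _ = + 0

t : Series
t zero (suc zero) = + 1
t _ _ = + 0

_^ₛ_ : Series → ℕ → Series
f ^ₛ zero  = # 1
f ^ₛ suc m = f ⊛ f ^ₛ m

Igf : Rel → Rel → Rel → Series
Igf R₁ R₂ R₃ n k = + length (filter (λ e → dist e ℕ.≟ k) (avoiders R₁ R₂ R₃ n))

{-# OPTIONS --safe #-}
module Submission where

-- Build the sequences letter by letter.  What matters about an avoiding word is its length n, the set M of its
-- letters, and the set F of letters whose insertion would complete the pattern, so the generating function of
-- its continuations is the sum over the next letter v of z (times t if v is new) times that of the extended
-- word.  Such a system has a unique solution z-adically, hence it suffices to exhibit one, after multiplication
-- by a common denominator c.  In each case a word first passes through a simple phase (all letters 0, or
-- 0, 1, …, a - 1, or weakly increasing) during which F is empty; the letter that ends it starts a phase in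
-- which the word is constant or decreases, and the decreasing continuations are counted by a product over the
-- smaller letters.  The weakly increasing phase gives a linear recurrence in the gap between the maximum and
-- the length; its solutions are powers of the power series root of the kernel equation
-- z λ² - (1 + z - z t) λ + q = 0, and this root carries the square root.

open import Defs
open import Algebra.Bundles using (CommutativeRing; RawRing)
open import Algebra.Morphism.Structures using (IsRingMonomorphism)
import Algebra.Morphism.RingMonomorphism as RingMonomorphism
import Algebra.Solver.Ring
open import Algebra.Solver.Ring.AlmostCommutativeRing using (fromCommutativeRing; _-Raw-AlmostCommutative⟶_)
open import Algebra.Structures using (IsCommutativeRing)
open import Data.Bool using (Bool; true; false; _∨_; if_then_else_; T)
open import Data.Bool.Properties using (∨-zeroʳ; ∨-identityʳ)
open import Data.Empty using (⊥; ⊥-elim)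
open import Data.Fin as Fin using (Fin; zero; suc; fromℕ; inject₁)
open import Data.Fin.Properties using (any?; toℕ-fromℕ; toℕ-inject₁; toℕ<n)
open import Data.Fin.Relation.Unary.Top using (view; ‵fromℕ; ‵inject₁)
open import Data.Integer as ℤ using (ℤ; +_)
import Data.Integer.Properties as ℤₚ
open import Data.List using (List; []; _∷_; _++_; length; filter; map; concatMap; upTo; deduplicate)
import Data.List.Properties as Listₚ
open import Data.Maybe using (Maybe; just; nothing)
open import Data.Nat as ℕ using (ℕ; zero; suc; _∸_; _≤_; _<_; z≤n; s≤s)
import Data.Nat.Properties as ℕₚ
open import Data.Product using (_×_; ∃; _,_)
open import Data.Sum using (_⊎_; inj₁; inj₂; [_,_]′)
open import Data.Unit using (⊤; tt)
open import Data.Vec using (Vec; []; _∷_; _∷ʳ_; lookup; toList)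
open import Function using (_∘_; id; _⇔_; mk⇔; Equivalence)
open import Level using (0ℓ)
open import Relation.Binary.PropositionalEquality using (_≡_; _≢_; refl; sym; trans; cong; cong₂; subst; subst₂)
open import Relation.Nullary using (¬_; Dec; yes; no; ¬?; contradiction)

open Equivalence using (to; from)

-- The states include arbitrary sets of seen letters, so there is no finite system to solve: a
-- closed form is guessed for every state and checked against the recurrence. The guess copies the
-- shape of the recurrence. Where decreasing phases follow, it is built from powers of the factor
-- contributed by one smaller letter; where constant phases follow, it is affine in the length or in
-- a weighted number of letters. Comparing coefficients leaves a few linear equations; α and β are
-- their solutions, and c clears the denominators that remain, since only reciprocals of the form
-- 1/(1 - z b) are constructed as series. In the weakly increasing phase a new maximum may skip
-- letters, and each skipped letter is a possible new letter later. Summing over the number of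
-- skipped letters gives a convolution, which one shift removes. Of the two roots of the resulting
-- kernel only one is a power series, as the other begins with 1/z; so one coefficient is left, and
-- the boundary equation fixes it. The square root is defined from this root, and its square is
-- computed from the kernel equation.

-- Power series in one variable over a commutative ring, iterated to give series in t and z

module Convolution (R : CommutativeRing 0ℓ 0ℓ) where
  open CommutativeRing R renaming (refl to ≈-refl; sym to ≈-sym; trans to ≈-trans; reflexive to ≈-reflexive)
    hiding (isCommutativeRing)
  open import Relation.Binary.Reasoning.Setoid setoid
  open import Algebra.Properties.CommutativeSemigroup +-commutativeSemigroup using (interchange)

  Seq : Set
  Seq = ℕ → Carrier

  infix 4 _≈ₛ_
  _≈ₛ_ : Seq → Seq → Set
  f ≈ₛ g = ∀ n → f n ≈ g n

  sumUpTo : ℕ → Seq → Carrier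
  sumUpTo zero    f = f 0
  sumUpTo (suc n) f = sumUpTo n f + f (suc n)

  tail : Seq → Seq
  tail f n = f (suc n)

  infixl 6 _+ₛ_
  infixl 7 _*ₛ_ _•_

  _+ₛ_ _*ₛ_ : Seq → Seq → Seq
  (f +ₛ g) n = f n + g n
  (f *ₛ g) n = sumUpTo n λ i → f i * g (n ∸ i)

  _•_ : Carrier → Seq → Seq
  (c • f) n = c * f n

  -ₛ_ : Seq → Seq
  (-ₛ f) n = - f n

  0ₛ 1ₛ : Seq
  0ₛ n = 0#
  1ₛ zero    = 1#
  1ₛ (suc n) = 0#

  sum-cong : ∀ n {f g : Seq} → (∀ i → i ≤ n → f i ≈ g i) → sumUpTo n f ≈ sumUpTo n g
  sum-cong zero    f≈g = f≈g 0 z≤n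
  sum-cong (suc n) f≈g =
    +-cong (sum-cong n (λ i i≤n → f≈g i (ℕₚ.m≤n⇒m≤1+n i≤n))) (f≈g (suc n) ℕₚ.≤-refl)

  sum-suc : ∀ n f → sumUpTo (suc n) f ≈ f 0 + sumUpTo n (tail f)
  sum-suc zero    f = ≈-refl
  sum-suc (suc n) f = ≈-trans (+-congʳ (sum-suc n f)) (+-assoc _ _ _)

  sum-+ : ∀ n f g → sumUpTo n (f +ₛ g) ≈ sumUpTo n f + sumUpTo n g
  sum-+ zero    f g = ≈-refl
  sum-+ (suc n) f g = ≈-trans (+-congʳ (sum-+ n f g)) (interchange _ _ _ _)

  sum-• : ∀ n c f → sumUpTo n (c • f) ≈ c * sumUpTo n f
  sum-• zero    c f = ≈-refl
  sum-• (suc n) c f = ≈-trans (+-congʳ (sum-• n c f)) (≈-sym (distribˡ _ _ _))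

  *ₛ-cong : ∀ {f f′ g g′} → f ≈ₛ f′ → g ≈ₛ g′ → f *ₛ g ≈ₛ f′ *ₛ g′
  *ₛ-cong p q n = sum-cong n λ i _ → *-cong (p i) (q (n ∸ i))

  *ₛ-sucˡ : ∀ f g n → (f *ₛ g) (suc n) ≈ f 0 * g (suc n) + (tail f *ₛ g) n
  *ₛ-sucˡ f g n = sum-suc n _

  *ₛ-sucʳ : ∀ f g n → (f *ₛ g) (suc n) ≈ (f *ₛ tail g) n + f (suc n) * g 0
  *ₛ-sucʳ f g n = +-cong
    (sum-cong n λ i i≤n → *-congˡ (≈-reflexive (cong g (ℕₚ.+-∸-assoc 1 i≤n))))
    (*-congˡ (≈-reflexive (cong g (ℕₚ.n∸n≡0 n))))

  -- Splitting off the first term of one product and the last term of the other lets both sides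
  -- match by induction, without reversing a sum.
  *ₛ-comm : ∀ f g → f *ₛ g ≈ₛ g *ₛ f
  *ₛ-comm f g zero    = *-comm _ _
  *ₛ-comm f g (suc n) = begin
    (f *ₛ g) (suc n)                 ≈⟨ *ₛ-sucˡ f g n ⟩
    f 0 * g (suc n) + (tail f *ₛ g) n ≈⟨ +-cong (*-comm _ _) (*ₛ-comm (tail f) g n) ⟩
    g (suc n) * f 0 + (g *ₛ tail f) n ≈⟨ +-comm _ _ ⟩
    (g *ₛ tail f) n + g (suc n) * f 0 ≈⟨ *ₛ-sucʳ g f n ⟨
    (g *ₛ f) (suc n)                 ∎

  *ₛ-distribʳ : ∀ f g h → (g +ₛ h) *ₛ f ≈ₛ (g *ₛ f) +ₛ (h *ₛ f)
  *ₛ-distribʳ f g h n = ≈-trans (sum-cong n λ i _ → distribʳ _ _ _) (sum-+ n _ _)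

  •-*ₛ : ∀ c f g → (c • f) *ₛ g ≈ₛ c • (f *ₛ g)
  •-*ₛ c f g n = ≈-trans (sum-cong n λ i _ → *-assoc _ _ _) (sum-• n c _)

  *ₛ-assoc : ∀ f g h → (f *ₛ g) *ₛ h ≈ₛ f *ₛ (g *ₛ h)
  *ₛ-assoc f g h zero    = *-assoc _ _ _
  *ₛ-assoc f g h (suc n) = begin
    ((f *ₛ g) *ₛ h) (suc n)
      ≈⟨ *ₛ-sucˡ (f *ₛ g) h n ⟩
    f 0 * g 0 * h (suc n) + (tail (f *ₛ g) *ₛ h) n
      ≈⟨ +-cong (*-assoc _ _ _) (*ₛ-cong {g = h} (*ₛ-sucˡ f g) (λ _ → ≈-refl) n) ⟩
    f 0 * (g 0 * h (suc n)) + ((f 0 • tail g +ₛ (tail f *ₛ g)) *ₛ h) n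
      ≈⟨ +-congˡ (*ₛ-distribʳ h _ _ n) ⟩
    f 0 * (g 0 * h (suc n)) + (((f 0 • tail g) *ₛ h) n + ((tail f *ₛ g) *ₛ h) n)
      ≈⟨ +-congˡ (+-cong (•-*ₛ (f 0) (tail g) h n) (*ₛ-assoc (tail f) g h n)) ⟩
    f 0 * (g 0 * h (suc n)) + (f 0 * (tail g *ₛ h) n + (tail f *ₛ (g *ₛ h)) n)
      ≈⟨ +-assoc _ _ _ ⟨
    f 0 * (g 0 * h (suc n)) + f 0 * (tail g *ₛ h) n + (tail f *ₛ (g *ₛ h)) n
      ≈⟨ +-congʳ (≈-trans (≈-sym (distribˡ _ _ _)) (*-congˡ (≈-sym (*ₛ-sucˡ g h n)))) ⟩
    f 0 * (g *ₛ h) (suc n) + (tail f *ₛ (g *ₛ h)) n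
      ≈⟨ *ₛ-sucˡ f (g *ₛ h) n ⟨
    (f *ₛ (g *ₛ h)) (suc n) ∎

  *ₛ-zeroˡ : ∀ f → 0ₛ *ₛ f ≈ₛ 0ₛ
  *ₛ-zeroˡ f zero    = zeroˡ _
  *ₛ-zeroˡ f (suc n) = begin
    (0ₛ *ₛ f) (suc n)               ≈⟨ *ₛ-sucˡ 0ₛ f n ⟩
    0# * f (suc n) + (0ₛ *ₛ f) n    ≈⟨ +-cong (zeroˡ _) (*ₛ-zeroˡ f n) ⟩
    0# + 0#                         ≈⟨ +-identityʳ _ ⟩
    0#                              ∎

  *ₛ-identityˡ : ∀ f → 1ₛ *ₛ f ≈ₛ f
  *ₛ-identityˡ f zero    = *-identityˡ _
  *ₛ-identityˡ f (suc n) = begin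
    (1ₛ *ₛ f) (suc n)                    ≈⟨ *ₛ-sucˡ 1ₛ f n ⟩
    1# * f (suc n) + (0ₛ *ₛ f) n         ≈⟨ +-cong (*-identityˡ _) (*ₛ-zeroˡ f n) ⟩
    f (suc n) + 0#                       ≈⟨ +-identityʳ _ ⟩
    f (suc n)                            ∎

  isCommutativeRing : IsCommutativeRing _≈ₛ_ _+ₛ_ _*ₛ_ -ₛ_ 0ₛ 1ₛ
  isCommutativeRing = record
    { isRing = record
      { +-isAbelianGroup = record
        { isGroup = record
          { isMonoid = record
            { isSemigroup = record
              { isMagma = record
                { isEquivalence = record
                  { refl  = λ _ → ≈-refl
                  ; sym   = λ p n → ≈-sym (p n)
                  ; trans = λ p q n → ≈-trans (p n) (q n)
                  }
                ; ∙-cong = λ p q n → +-cong (p n) (q n)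
                }
              ; assoc = λ f g h n → +-assoc _ _ _
              }
            ; identity = (λ f n → +-identityˡ _) , (λ f n → +-identityʳ _)
            }
          ; inverse = (λ f n → -‿inverseˡ _) , (λ f n → -‿inverseʳ _)
          ; ⁻¹-cong = λ p n → -‿cong (p n)
          }
        ; comm = λ f g n → +-comm _ _
        }
      ; *-cong     = *ₛ-cong
      ; *-assoc    = *ₛ-assoc
      ; *-identity = *ₛ-identityˡ , λ f n → ≈-trans (*ₛ-comm f 1ₛ n) (*ₛ-identityˡ f n)
      ; distrib    = (λ f g h n → ≈-trans (*ₛ-comm f (g +ₛ h) n)
                       (≈-trans (*ₛ-distribʳ f g h n) (+-cong (*ₛ-comm g f n) (*ₛ-comm h f n))))
                   , *ₛ-distribʳ
      }
    ; *-comm = *ₛ-comm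
    }

  commutativeRing : CommutativeRing 0ℓ 0ℓ
  commutativeRing = record { isCommutativeRing = isCommutativeRing }

infix 4 _≃_
-- A wrapper around _≋_ from which Agda can infer the two series.
record _≃_ (f g : Series) : Set where
  constructor mk
  field at : f ≋ g
open _≃_ public

⊝_ : Series → Series
(⊝ f) n k = ℤ.- f n k

module ℤ[[t]] = Convolution ℤₚ.+-*-commutativeRing
module ℤ[[t,z]] = Convolution ℤ[[t]].commutativeRing

sumTo≡ : ∀ k f → sumTo k f ≡ ℤ[[t]].sumUpTo k f
sumTo≡ zero    f = refl
sumTo≡ (suc k) f = cong (ℤ._+ f (suc k)) (sumTo≡ k f)

sumUpTo-at : ∀ n (F : ℕ → ℤ[[t]].Seq) k → ℤ[[t,z]].sumUpTo n F k ≡ ℤ[[t]].sumUpTo n (λ i → F i k)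
sumUpTo-at zero    F k = refl
sumUpTo-at (suc n) F k = cong (ℤ._+ F (suc n) k) (sumUpTo-at n F k)

⊛≋*ₛ : ∀ f g → f ⊛ g ≋ f ℤ[[t,z]].*ₛ g
⊛≋*ₛ f g n k = trans (sumTo≡ n _) (trans
  (ℤ[[t]].sum-cong n λ i _ → sumTo≡ k _)
  (sym (sumUpTo-at n _ k)))

#0≋0ₛ : # 0 ≋ ℤ[[t,z]].0ₛ
#0≋0ₛ zero    zero    = refl
#0≋0ₛ zero    (suc k) = refl
#0≋0ₛ (suc n) k       = refl

#1≋1ₛ : # 1 ≋ ℤ[[t,z]].1ₛ
#1≋1ₛ zero    zero    = refl
#1≋1ₛ zero    (suc k) = refl
#1≋1ₛ (suc n) k       = refl

seriesRawRing : RawRing 0ℓ 0ℓ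
seriesRawRing = record
  { Carrier = Series ; _≈_ = _≃_ ; _+_ = _⊕_ ; _*_ = _⊛_ ; -_ = ⊝_ ; 0# = # 0 ; 1# = # 1 }

-- The product `⊛` and the iterated convolution agree only coefficient by coefficient, so the ring
-- laws are transported along the identity map.
isMonomorphism : IsRingMonomorphism seriesRawRing (CommutativeRing.rawRing ℤ[[t,z]].commutativeRing) (λ f → f)
isMonomorphism = record
  { isRingHomomorphism = record
    { isSemiringHomomorphism = record
      { isNearSemiringHomomorphism = record
        { +-isMonoidHomomorphism = record
          { isMagmaHomomorphism = record
            { isRelHomomorphism = record { cong = at }
            ; homo = λ f g n k → refl
            }
          ; ε-homo = #0≋0ₛ
          }
        ; *-homo = ⊛≋*ₛ
        }
      ; 1#-homo = #1≋1ₛ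
      }
    ; -‿homo = λ f n k → refl
    }
  ; injective = mk
  }

seriesRing : CommutativeRing 0ℓ 0ℓ
seriesRing = record
  { isCommutativeRing = RingMonomorphism.isCommutativeRing isMonomorphism ℤ[[t,z]].isCommutativeRing }

open CommutativeRing seriesRing public
  using (setoid)
  renaming (refl to ≃-refl; sym to ≃-sym; trans to ≃-trans; reflexive to ≃-reflexive)

⊕-congˡ : ∀ f {g h} → g ≃ h → f ⊕ g ≃ f ⊕ h
⊕-congˡ f = CommutativeRing.+-congˡ seriesRing {f}

⊕-congʳ : ∀ f {g h} → g ≃ h → g ⊕ f ≃ h ⊕ f
⊕-congʳ f = CommutativeRing.+-congʳ seriesRing {f}

⊕-cong : ∀ {f f′ g g′} → f ≃ f′ → g ≃ g′ → f ⊕ g ≃ f′ ⊕ g′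
⊕-cong = CommutativeRing.+-cong seriesRing

⊛-congˡ : ∀ f {g h} → g ≃ h → f ⊛ g ≃ f ⊛ h
⊛-congˡ f = CommutativeRing.*-congˡ seriesRing {f}

⊛-congʳ : ∀ f {g h} → g ≃ h → g ⊛ f ≃ h ⊛ f
⊛-congʳ f = CommutativeRing.*-congʳ seriesRing {f}

-- Coefficients of series

sumTo-head : ∀ n f → (∀ i → f (suc i) ≡ + 0) → sumTo n f ≡ f 0
sumTo-head zero    f f≡0 = refl
sumTo-head (suc n) f f≡0 =
  trans (cong₂ ℤ._+_ (sumTo-head n f f≡0) (f≡0 n)) (ℤₚ.+-identityʳ _)

sumTo-0 : ∀ n f → (∀ i → f i ≡ + 0) → sumTo n f ≡ + 0
sumTo-0 n f f≡0 = trans (sumTo-head n f (λ i → f≡0 (suc i))) (f≡0 0)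

cst-⊛ : ∀ c f n k → (cst c ⊛ f) n k ≡ c ℤ.* f n k
cst-⊛ c f n k = trans
  (sumTo-head n _ λ i → sumTo-0 k _ λ j → refl)
  (sumTo-head k _ λ j → refl)

cst-+ : ∀ a b → cst (a ℤ.+ b) ≋ cst a ⊕ cst b
cst-+ a b zero    zero    = refl
cst-+ a b zero    (suc k) = refl
cst-+ a b (suc n) k       = refl

cst-* : ∀ a b → cst (a ℤ.* b) ≋ cst a ⊛ cst b
cst-* a b n k = trans (scale n k) (sym (cst-⊛ a (cst b) n k))
  where
  scale : ∀ n k → cst (a ℤ.* b) n k ≡ a ℤ.* cst b n k
  scale zero    zero    = refl
  scale zero    (suc k) = sym (ℤₚ.*-zeroʳ a)
  scale (suc n) k       = sym (ℤₚ.*-zeroʳ a)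

cst-neg : ∀ a → cst (ℤ.- a) ≋ ⊝ cst a
cst-neg a zero    zero    = refl
cst-neg a zero    (suc k) = refl
cst-neg a (suc n) k       = refl

cst-morphism : CommutativeRing.rawRing ℤₚ.+-*-commutativeRing
                 -Raw-AlmostCommutative⟶ fromCommutativeRing seriesRing
cst-morphism = record
  { ⟦_⟧    = cst
  ; +-homo = λ a b → mk (cst-+ a b)
  ; *-homo = λ a b → mk (cst-* a b)
  ; -‿homo = λ a → mk (cst-neg a)
  ; 0-homo = ≃-refl
  ; 1-homo = ≃-refl
  }

cst-≟ : ∀ a b → Maybe (cst a ≃ cst b)
cst-≟ a b with a ℤ.≟ b
... | yes refl = just ≃-refl
... | no  _    = nothing

open Algebra.Solver.Ring (CommutativeRing.rawRing ℤₚ.+-*-commutativeRing)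
  (fromCommutativeRing seriesRing) cst-morphism cst-≟ public
  using (solve; _:=_; _:+_; _:*_; _:-_; :-_; con; Polynomial)

infixr 9 _^′_
_^′_ : ∀ {n} → Polynomial n → ℕ → Polynomial n
p ^′ zero  = con (+ 1)
p ^′ suc m = p :* p ^′ m

1′ 2′ 3′ 4′ : ∀ {n} → Polynomial n
1′ = con (+ 1)
2′ = con (+ 2)
3′ = con (+ 3)
4′ = con (+ 4)

z-⊛-zero : ∀ f k → (z ⊛ f) 0 k ≡ + 0
z-⊛-zero f k = sumTo-0 k _ λ j → refl

z-⊛-suc : ∀ f n k → (z ⊛ f) (suc n) k ≡ f n k
z-⊛-suc f n k = trans (⊛≋*ₛ z f (suc n) k) (trans (ℤ[[t,z]].*ₛ-sucˡ z f n k)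
  (trans (cong₂ ℤ._+_ head-0 (trans (ℤ[[t,z]].*ₛ-cong {g = f} tail-z (λ _ _ → refl) n k) (ℤ[[t,z]].*ₛ-identityˡ f n k)))
    (ℤₚ.+-identityˡ _)))
  where
  head-0 : (z 0 ℤ[[t]].*ₛ f (suc n)) k ≡ + 0
  head-0 = trans (sym (sumTo≡ k _)) (sumTo-0 k _ λ j → refl)
  tail-z : ℤ[[t,z]].tail z ℤ[[t,z]].≈ₛ ℤ[[t,z]].1ₛ
  tail-z zero    zero    = refl
  tail-z zero    (suc k) = refl
  tail-z (suc n) k       = refl

-- Congruence modulo powers of z, and fixed points

AgreeBelow : ℕ → Series → Series → Set
AgreeBelow N f g = ∀ n → n < N → ∀ k → f n k ≡ g n k

agree-≃ : ∀ {N f f′ g g′} → f ≃ f′ → g ≃ g′ → AgreeBelow N f′ g′ → AgreeBelow N f g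
agree-≃ p q agree n n<N k = trans (at p n k) (trans (agree n n<N k) (sym (at q n k)))

agree-⊕ : ∀ {N f f′ g g′} → AgreeBelow N f f′ → AgreeBelow N g g′ → AgreeBelow N (f ⊕ g) (f′ ⊕ g′)
agree-⊕ p q n n<N k = cong₂ ℤ._+_ (p n n<N k) (q n n<N k)

agree-⊛ : ∀ {N f f′ g g′} → AgreeBelow N f f′ → AgreeBelow N g g′ → AgreeBelow N (f ⊛ g) (f′ ⊛ g′)
agree-⊛ {f = f} {f′} {g} {g′} p q n n<N k =
  trans (⊛≋*ₛ f g n k) (trans (ℤ[[t,z]].sum-cong n termwise k) (sym (⊛≋*ₛ f′ g′ n k)))
  where
  termwise : ∀ i → i ≤ n → (f i ℤ[[t]].*ₛ g (n ∸ i)) ℤ[[t]].≈ₛ (f′ i ℤ[[t]].*ₛ g′ (n ∸ i))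
  termwise i i≤n = ℤ[[t]].*ₛ-cong (p i (ℕₚ.≤-<-trans i≤n n<N))
                              (q (n ∸ i) (ℕₚ.≤-<-trans (ℕₚ.m∸n≤m n i) n<N))

-- The factor z gains one order; both the fixed points and the uniqueness of generating functions
-- rest on this.
agree-z⊛ : ∀ {N f g} → AgreeBelow N f g → AgreeBelow (suc N) (z ⊛ f) (z ⊛ g)
agree-z⊛ {f = f} {g} p zero    _         k = trans (z-⊛-zero f k) (sym (z-⊛-zero g k))
agree-z⊛ {f = f} {g} p (suc n) (s≤s n<N) k =
  trans (z-⊛-suc f n k) (trans (p n n<N k) (sym (z-⊛-suc g n k)))

-- The solution of f = a + z (b f + c f²) is the z-adic limit of the iterates of the right-hand side.
module Quadratic (a b c : Series) where

  step : Series → Series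
  step f = a ⊕ z ⊛ (b ⊛ f ⊕ c ⊛ (f ⊛ f))

  step-contracts : ∀ {N f g} → AgreeBelow N f g → AgreeBelow (suc N) (step f) (step g)
  step-contracts p = agree-⊕ {f = a} {a} (λ _ _ _ → refl) (agree-z⊛
    (agree-⊕ (agree-⊛ {f = b} (λ _ _ _ → refl) p) (agree-⊛ {f = c} (λ _ _ _ → refl) (agree-⊛ p p))))

  iterate : ℕ → Series
  iterate zero    = # 0
  iterate (suc N) = step (iterate N)

  -- The coefficient of order n is final from the iterate n + 1 onwards.
  solution : Series
  solution n = iterate (suc n) n

  iterate-stable : ∀ N → AgreeBelow N (iterate N) (iterate (suc N))
  iterate-stable zero    n ()
  iterate-stable (suc N) = step-contracts (iterate-stable N)

  solution-agrees : ∀ N → AgreeBelow N solution (iterate N)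
  solution-agrees (suc N) n (s≤s n≤N) k with ℕₚ.m≤n⇒m<n∨m≡n n≤N
  ... | inj₁ n<N  = trans (solution-agrees N n n<N k) (iterate-stable N n n<N k)
  ... | inj₂ refl = refl

  solution-eq : solution ≃ step solution
  solution-eq = mk λ n k →
    sym (step-contracts (solution-agrees n) n ℕₚ.≤-refl k)

t^-zero : ∀ d k → (t ^ₛ d) 0 k ≡ (if d ℕ.≡ᵇ k then + 1 else + 0)
t^-zero zero    zero    = refl
t^-zero zero    (suc k) = refl
t^-zero (suc d) zero    = refl
t^-zero (suc d) (suc k) = trans (⊛≋*ₛ t (t ^ₛ d) 0 (suc k)) (trans (ℤ[[t]].*ₛ-sucˡ (t 0) ((t ^ₛ d) 0) k)
  (trans (ℤₚ.+-identityˡ _) (trans (ℤ[[t]].*ₛ-cong {g = (t ^ₛ d) 0} tail-t (λ _ → refl) k)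
    (trans (ℤ[[t]].*ₛ-identityˡ ((t ^ₛ d) 0) k) (t^-zero d k)))))
  where
  tail-t : ℤ[[t]].tail (t 0) ℤ[[t]].≈ₛ ℤ[[t]].1ₛ
  tail-t zero    = refl
  tail-t (suc k) = refl

t^-suc : ∀ d n k → (t ^ₛ d) (suc n) k ≡ + 0
t^-suc zero    n k = refl
t^-suc (suc d) n k = sumTo-0 (suc n) _ λ where
  zero    → sumTo-0 k _ λ j → trans (cong (t 0 j ℤ.*_) (t^-suc d n (k ∸ j))) (ℤₚ.*-zeroʳ (t 0 j))
  (suc i) → sumTo-0 k _ λ j → refl

-- Words

lookup-∷ʳ-inject₁ : ∀ {n} (e : Vec ℕ n) v i → lookup (e ∷ʳ v) (inject₁ i) ≡ lookup e i
lookup-∷ʳ-inject₁ (x ∷ e) v zero    = refl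
lookup-∷ʳ-inject₁ (x ∷ e) v (suc i) = lookup-∷ʳ-inject₁ e v i

lookup-∷ʳ-fromℕ : ∀ {n} (e : Vec ℕ n) v → lookup (e ∷ʳ v) (fromℕ n) ≡ v
lookup-∷ʳ-fromℕ []      v = refl
lookup-∷ʳ-fromℕ (x ∷ e) v = lookup-∷ʳ-fromℕ e v

Visited : ∀ {n} → Vec ℕ n → ℕ → Set
Visited e x = ∃ λ i → lookup e i ≡ x

visited? : ∀ {n} (e : Vec ℕ n) x → Dec (Visited e x)
visited? e x = any? λ i → lookup e i ℕ.≟ x

visited-∷ʳ : ∀ {n} (e : Vec ℕ n) v x → Visited (e ∷ʳ v) x ⇔ (Visited e x ⊎ x ≡ v)
visited-∷ʳ e v x = mk⇔ split join
  where
  split : Visited (e ∷ʳ v) x → Visited e x ⊎ x ≡ v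
  split (i , p) with view i
  ... | ‵fromℕ     = inj₂ (trans (sym p) (lookup-∷ʳ-fromℕ e v))
  ... | ‵inject₁ i = inj₁ (i , trans (sym (lookup-∷ʳ-inject₁ e v i)) p)
  join : Visited e x ⊎ x ≡ v → Visited (e ∷ʳ v) x
  join (inj₁ (i , p)) = inject₁ i , trans (lookup-∷ʳ-inject₁ e v i) p
  join (inj₂ refl)    = fromℕ _ , lookup-∷ʳ-fromℕ e v

dedup : List ℕ → List ℕ
dedup = deduplicate ℕ._≟_

-- Deduplication keeps first occurrences, and each kept letter filters its later copies out of the
-- rest. A letter v that occurs only as the head is thus new for the tail, which is why this proof
-- calls the other one.
dedup-∷ʳ-old : ∀ {n} (e : Vec ℕ n) v → Visited e v → dedup (toList (e ∷ʳ v)) ≡ dedup (toList e)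
dedup-∷ʳ-new : ∀ {n} (e : Vec ℕ n) v → ¬ Visited e v → dedup (toList (e ∷ʳ v)) ≡ dedup (toList e) ++ v ∷ []

dedup-∷ʳ-old (x ∷ e) v visited with visited? e v
dedup-∷ʳ-old (x ∷ e) v visited         | yes old = cong (λ l → x ∷ filter _ l) (dedup-∷ʳ-old e v old)
dedup-∷ʳ-old (x ∷ e) v (suc i , p)     | no new  = contradiction (i , p) new
-- Here v equals the head only: the tail appends it, and the filter of the head removes it again.
dedup-∷ʳ-old (x ∷ e) v (zero  , refl)  | no new  = cong (x ∷_) (trans
  (cong (filter ≢x?) (dedup-∷ʳ-new e v new))
  (trans (Listₚ.filter-++ ≢x? (dedup (toList e)) (x ∷ []))
    (trans (cong (filter ≢x? (dedup (toList e)) ++_) (Listₚ.filter-reject ≢x? (λ x≢x → x≢x refl)))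
      (Listₚ.++-identityʳ _))))
  where
  ≢x? = λ y → ¬? (x ℕ.≟ y)

dedup-∷ʳ-new []      v new = refl
dedup-∷ʳ-new (x ∷ e) v new = cong (x ∷_) (trans
  (cong (filter ≢x?) (dedup-∷ʳ-new e v (λ (i , p) → new (suc i , p))))
  (trans (Listₚ.filter-++ ≢x? (dedup (toList e)) (v ∷ []))
    (cong (filter ≢x? (dedup (toList e)) ++_) (Listₚ.filter-accept ≢x? (λ x≡v → new (zero , x≡v))))))
  where
  ≢x? = λ y → ¬? (x ℕ.≟ y)

dist-old : ∀ {n} (e : Vec ℕ n) v → Visited e v → dist (e ∷ʳ v) ≡ dist e
dist-old e v old = cong length (dedup-∷ʳ-old e v old)

dist-new : ∀ {n} (e : Vec ℕ n) v → ¬ Visited e v → dist (e ∷ʳ v) ≡ suc (dist e)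
dist-new e v new = trans (cong length (dedup-∷ʳ-new e v new))
  (trans (Listₚ.length-++ (dedup (toList e))) (ℕₚ.+-comm _ 1))

_∪_ : (ℕ → Bool) → ℕ → ℕ → Bool
(M ∪ v) x = M x ∨ (x ℕ.≡ᵇ v)

module Avoidance (R₁ R₂ R₃ : Rel) where

  Forbidden : ∀ {n} → Vec ℕ n → ℕ → Set
  Forbidden {n} e u = ∃ λ (i : Fin n) → ∃ λ (j : Fin n) → i Fin.< j ×
    ⟦ R₁ ⟧ (lookup e i) (lookup e j) × ⟦ R₂ ⟧ (lookup e j) u × ⟦ R₃ ⟧ (lookup e i) u

  -- An occurrence that involves the last position can only use it for its third letter.
  contains-∷ʳ : ∀ {n} (e : Vec ℕ n) v →
    Contains R₁ R₂ R₃ (e ∷ʳ v) ⇔ (Contains R₁ R₂ R₃ e ⊎ Forbidden e v)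
  contains-∷ʳ {n} e v = mk⇔ split join
    where
    split : Contains R₁ R₂ R₃ (e ∷ʳ v) → Contains R₁ R₂ R₃ e ⊎ Forbidden e v
    split (i , j , k , i<j , j<k , r₁ , r₂ , r₃) with view i | view j | view k
    ... | _ | ‵fromℕ | ‵fromℕ = contradiction j<k (ℕₚ.<-irrefl refl)
    ... | _ | ‵fromℕ | ‵inject₁ k = contradiction
      (subst₂ _<_ (toℕ-fromℕ n) (toℕ-inject₁ k) j<k) (ℕₚ.≤⇒≯ (ℕₚ.<⇒≤ (toℕ<n k)))
    ... | ‵fromℕ | ‵inject₁ j | _ = contradiction
      (subst₂ _<_ (toℕ-fromℕ n) (toℕ-inject₁ j) i<j) (ℕₚ.≤⇒≯ (ℕₚ.<⇒≤ (toℕ<n j)))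
    ... | ‵inject₁ i | ‵inject₁ j | ‵fromℕ
      rewrite lookup-∷ʳ-inject₁ e v i | lookup-∷ʳ-inject₁ e v j | lookup-∷ʳ-fromℕ e v =
      inj₂ (i , j , subst₂ _<_ (toℕ-inject₁ i) (toℕ-inject₁ j) i<j , r₁ , r₂ , r₃)
    ... | ‵inject₁ i | ‵inject₁ j | ‵inject₁ k
      rewrite lookup-∷ʳ-inject₁ e v i | lookup-∷ʳ-inject₁ e v j | lookup-∷ʳ-inject₁ e v k =
      inj₁ (i , j , k , subst₂ _<_ (toℕ-inject₁ i) (toℕ-inject₁ j) i<j
                      , subst₂ _<_ (toℕ-inject₁ j) (toℕ-inject₁ k) j<k , r₁ , r₂ , r₃)
    join : Contains R₁ R₂ R₃ e ⊎ Forbidden e v → Contains R₁ R₂ R₃ (e ∷ʳ v)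
    join (inj₁ (i , j , k , i<j , j<k , r))
      rewrite sym (lookup-∷ʳ-inject₁ e v i) | sym (lookup-∷ʳ-inject₁ e v j) | sym (lookup-∷ʳ-inject₁ e v k) =
      inject₁ i , inject₁ j , inject₁ k
        , subst₂ _<_ (sym (toℕ-inject₁ i)) (sym (toℕ-inject₁ j)) i<j
        , subst₂ _<_ (sym (toℕ-inject₁ j)) (sym (toℕ-inject₁ k)) j<k , r
    join (inj₂ (i , j , i<j , r₁ , r₂ , r₃)) = inject₁ i , inject₁ j , fromℕ n
        , subst₂ _<_ (sym (toℕ-inject₁ i)) (sym (toℕ-inject₁ j)) i<j
        , subst₂ _<_ (sym (toℕ-inject₁ j)) (sym (toℕ-fromℕ n)) (toℕ<n j)
        , subst₂ ⟦ R₁ ⟧ (sym (lookup-∷ʳ-inject₁ e v i)) (sym (lookup-∷ʳ-inject₁ e v j)) r₁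
        , subst₂ ⟦ R₂ ⟧ (sym (lookup-∷ʳ-inject₁ e v j)) (sym (lookup-∷ʳ-fromℕ e v)) r₂
        , subst₂ ⟦ R₃ ⟧ (sym (lookup-∷ʳ-inject₁ e v i)) (sym (lookup-∷ʳ-fromℕ e v)) r₃

  -- A pair whose second member is the new letter depends on the value of its first member, not on
  -- its position; hence the forbidden set can be updated from itself and the set of seen letters
  -- alone.
  forbidden-∷ʳ : ∀ {n} (e : Vec ℕ n) v u → Forbidden (e ∷ʳ v) u ⇔
    (Forbidden e u ⊎ ∃ λ x → Visited e x × ⟦ R₁ ⟧ x v × ⟦ R₂ ⟧ v u × ⟦ R₃ ⟧ x u)
  forbidden-∷ʳ {n} e v u = mk⇔ split join
    where
    New : Set
    New = ∃ λ x → Visited e x × ⟦ R₁ ⟧ x v × ⟦ R₂ ⟧ v u × ⟦ R₃ ⟧ x u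
    split : Forbidden (e ∷ʳ v) u → Forbidden e u ⊎ New
    split (i , j , i<j , r₁ , r₂ , r₃) with view i | view j
    ... | ‵fromℕ | ‵fromℕ = contradiction i<j (ℕₚ.<-irrefl refl)
    ... | ‵fromℕ | ‵inject₁ j = contradiction
      (subst₂ _<_ (toℕ-fromℕ n) (toℕ-inject₁ j) i<j) (ℕₚ.≤⇒≯ (ℕₚ.<⇒≤ (toℕ<n j)))
    ... | ‵inject₁ i | ‵fromℕ
      rewrite lookup-∷ʳ-inject₁ e v i | lookup-∷ʳ-fromℕ e v = inj₂ (_ , (i , refl) , r₁ , r₂ , r₃)
    ... | ‵inject₁ i | ‵inject₁ j
      rewrite lookup-∷ʳ-inject₁ e v i | lookup-∷ʳ-inject₁ e v j =
      inj₁ (i , j , subst₂ _<_ (toℕ-inject₁ i) (toℕ-inject₁ j) i<j , r₁ , r₂ , r₃)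
    join : Forbidden e u ⊎ New → Forbidden (e ∷ʳ v) u
    join (inj₁ (i , j , i<j , r))
      rewrite sym (lookup-∷ʳ-inject₁ e v i) | sym (lookup-∷ʳ-inject₁ e v j) =
      inject₁ i , inject₁ j , subst₂ _<_ (sym (toℕ-inject₁ i)) (sym (toℕ-inject₁ j)) i<j , r
    join (inj₂ (_ , (i , refl) , r₁ , r₂ , r₃)) = inject₁ i , fromℕ n
        , subst₂ _<_ (sym (toℕ-inject₁ i)) (sym (toℕ-fromℕ n)) (toℕ<n i)
        , subst₂ ⟦ R₁ ⟧ (sym (lookup-∷ʳ-inject₁ e v i)) (sym (lookup-∷ʳ-fromℕ e v)) r₁
        , subst (λ x → ⟦ R₂ ⟧ x u) (sym (lookup-∷ʳ-fromℕ e v)) r₂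
        , subst (λ x → ⟦ R₃ ⟧ x u) (sym (lookup-∷ʳ-inject₁ e v i)) r₃

-- Generating functions of words

Σ< : ℕ → (ℕ → Series) → Series
Σ< zero    f = # 0
Σ< (suc n) f = Σ< n f ⊕ f n

infixr 5 _∷ʳ_≈_
-- A sum whose summand number v satisfies `P v`. As a datatype it can be assembled from blocks of
-- letters that are treated differently, such as those below, at and above a given letter.
data Sums (P : ℕ → Series → Set₁) : ℕ → Series → Set₁ where
  []    : ∀ {X} → X ≃ # 0 → Sums P 0 X
  _∷ʳ_≈_ : ∀ {n A x X} → Sums P n A → P n x → X ≃ A ⊕ x → Sums P (suc n) X

Sums-≃ : ∀ {P n X Y} → Y ≃ X → Sums P n X → Sums P n Y
Sums-≃ e ([] p)          = [] (≃-trans e p)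
Sums-≃ e (xs ∷ʳ x ≈ p) = xs ∷ʳ x ≈ ≃-trans e p

Sums-++ : ∀ {P} m {n A B} → Sums P m A → Sums (λ v → P (m ℕ.+ v)) n B → Sums P (m ℕ.+ n) (A ⊕ B)
Sums-++ {P} m {A = A} xs ([] {X} p) = subst (λ j → Sums P j (A ⊕ X)) (sym (ℕₚ.+-identityʳ m))
  (Sums-≃ (≃-trans (⊕-congˡ A p) (solve 1 (λ a → a :+ con (+ 0) := a) ≃-refl A)) xs)
Sums-++ {P} m {A = A} xs (_∷ʳ_≈_ {n} {B} {y} {X} ys x p) = subst (λ j → Sums P j (A ⊕ X)) (sym (ℕₚ.+-suc m n))
  (Sums-++ m xs ys ∷ʳ x ≈ ≃-trans (⊕-congˡ A p) (solve 3 (λ a b c → a :+ (b :+ c) := (a :+ b) :+ c) ≃-refl A B y))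

Sums-tabulate : ∀ {P} n f → (∀ v → v < n → P v (f v)) → Sums P n (Σ< n f)
Sums-tabulate zero    f p = [] ≃-refl
Sums-tabulate (suc n) f p =
  Sums-tabulate n f (λ v v<n → p v (ℕₚ.m≤n⇒m≤1+n v<n)) ∷ʳ p n ℕₚ.≤-refl ≈ ≃-refl

Σ<-⊛ : ∀ c n f → c ⊛ Σ< n f ≃ Σ< n (λ v → c ⊛ f v)
Σ<-⊛ c zero    f = solve 1 (λ c → c :* con (+ 0) := con (+ 0)) ≃-refl c
Σ<-⊛ c (suc n) f = ≃-trans
  (solve 3 (λ c a b → c :* (a :+ b) := c :* a :+ c :* b) ≃-refl c (Σ< n f) (f n)) (⊕-congʳ (c ⊛ f n) (Σ<-⊛ c n f))

sumOver : ∀ {A : Set} → List A → (A → ℤ) → ℤ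
sumOver []       f = + 0
sumOver (x ∷ xs) f = f x ℤ.+ sumOver xs f

sumOver-++ : ∀ {A : Set} (xs ys : List A) f → sumOver (xs ++ ys) f ≡ sumOver xs f ℤ.+ sumOver ys f
sumOver-++ []       ys f = sym (ℤₚ.+-identityˡ _)
sumOver-++ (x ∷ xs) ys f = trans (cong₂ ℤ._+_ (refl {x = f x}) (sumOver-++ xs ys f)) (sym (ℤₚ.+-assoc (f x) _ _))

sumOver-map : ∀ {A B : Set} (g : A → B) xs f → sumOver (map g xs) f ≡ sumOver xs (f ∘ g)
sumOver-map g []       f = refl
sumOver-map g (x ∷ xs) f = cong₂ ℤ._+_ (refl {x = f (g x)}) (sumOver-map g xs f)

sumOver-concatMap : ∀ {A B : Set} (g : A → List B) xs f →
  sumOver (concatMap g xs) f ≡ sumOver xs (λ x → sumOver (g x) f)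
sumOver-concatMap g []       f = refl
sumOver-concatMap g (x ∷ xs) f =
  trans (sumOver-++ (g x) (concatMap g xs) f) (cong₂ ℤ._+_ (refl {x = sumOver (g x) f}) (sumOver-concatMap g xs f))

sumOver-cong : ∀ {A : Set} (xs : List A) {f g} → (∀ x → f x ≡ g x) → sumOver xs f ≡ sumOver xs g
sumOver-cong []       p = refl
sumOver-cong (x ∷ xs) p = cong₂ ℤ._+_ (p x) (sumOver-cong xs p)

sumOver-0 : ∀ {A : Set} (xs : List A) f → (∀ x → f x ≡ + 0) → sumOver xs f ≡ + 0
sumOver-0 []       f p = refl
sumOver-0 (x ∷ xs) f p = cong₂ ℤ._+_ (p x) (sumOver-0 xs f p)

sumOver-upTo : ∀ n (F : ℕ → Series) N k → sumOver (upTo n) (λ v → F v N k) ≡ Σ< n F N k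
sumOver-upTo zero    F zero    zero    = refl
sumOver-upTo zero    F zero    (suc k) = refl
sumOver-upTo zero    F (suc N) k       = refl
sumOver-upTo (suc n) F N k = trans
  (cong (λ l → sumOver l (λ v → F v N k)) (sym (Listₚ.upTo-∷ʳ n)))
  (trans (sumOver-++ (upTo n) (n ∷ []) (λ v → F v N k))
    (cong₂ ℤ._+_ (sumOver-upTo n F N k) (ℤₚ.+-identityʳ (F n N k))))

≡ᵇ-refl : ∀ n → (n ℕ.≡ᵇ n) ≡ true
≡ᵇ-refl zero    = refl
≡ᵇ-refl (suc n) = ≡ᵇ-refl n

weight : Bool → Series
weight true  = # 1
weight false = t

-- The letters that complete the pattern after the letter v is appended.
data Extension (R₁ R₂ R₃ : Rel) (M : ℕ → Bool) (F : ℕ → Set) (v u : ℕ) : Set where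
  before : F u → Extension R₁ R₂ R₃ M F v u
  now    : ∀ x → M x ≡ true → ⟦ R₁ ⟧ x v → ⟦ R₂ ⟧ v u → ⟦ R₃ ⟧ x u → Extension R₁ R₂ R₃ M F v u

module Counting (R₁ R₂ R₃ : Rel) where
  open Avoidance R₁ R₂ R₃

  Avoids : ∀ {n} → Vec ℕ n → Set
  Avoids e = ¬ Contains R₁ R₂ R₃ e

  avoids? : ∀ {n} (e : Vec ℕ n) → Dec (Avoids e)
  avoids? e = ¬? (contains? R₁ R₂ R₃ e)

  tally : ∀ {n} → List (Vec ℕ n) → ℕ → ℤ
  tally es k = + length (filter (λ e → dist e ℕ.≟ k) (filter avoids? es))

  -- The exponent of z counts appended letters only, while that of t counts the distinct letters of
  -- the whole word; this is why `t ^ₛ dist e` is split off later.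
  extensions : ∀ {n} → Vec ℕ n → Series
  extensions     e zero    k = tally (e ∷ []) k
  extensions {n} e (suc N) k = sumOver (upTo (suc n)) (λ v → extensions (e ∷ʳ v) N k)

  tally-sum : ∀ {n} (es : List (Vec ℕ n)) k → tally es k ≡ sumOver es (λ e → tally (e ∷ []) k)
  tally-sum []       k = refl
  tally-sum (e ∷ es) k = trans
    (cong (λ l → + length (filter dist? l)) (Listₚ.filter-++ avoids? (e ∷ []) es)) (trans
    (cong (λ l → + length l) (Listₚ.filter-++ dist? (filter avoids? (e ∷ [])) (filter avoids? es))) (trans
    (cong +_ (Listₚ.length-++ (filter dist? (filter avoids? (e ∷ []))))) (trans
    (ℤₚ.pos-+ (length (filter dist? (filter avoids? (e ∷ [])))) _)
    (cong₂ ℤ._+_ (refl {x = tally (e ∷ []) k}) (tally-sum es k)))))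
    where
    dist? = λ e → dist e ℕ.≟ k

  extensions-allInv : ∀ N n k → sumOver (allInv n) (λ e → extensions e N k) ≡ Igf R₁ R₂ R₃ (N ℕ.+ n) k
  extensions-allInv zero    n k = sym (tally-sum (allInv n) k)
  extensions-allInv (suc N) n k = trans
    (sym (trans (sumOver-concatMap children (allInv n) _) (sumOver-cong (allInv n) λ e →
      sumOver-map (e ∷ʳ_) (upTo (suc n)) (λ e → extensions e N k))))
    (trans (extensions-allInv N (suc n) k) (cong (λ m → Igf R₁ R₂ R₃ m k) (ℕₚ.+-suc N n)))
    where
    children : Vec ℕ n → List (Vec ℕ (suc n))
    children e = map (e ∷ʳ_) (upTo (suc n))

  Igf≃extensions : Igf R₁ R₂ R₃ ≃ extensions []
  Igf≃extensions = mk λ N k → sym (trans (sym (ℤₚ.+-identityʳ _)) (trans (extensions-allInv N 0 k)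
    (cong (λ m → Igf R₁ R₂ R₃ m k) (ℕₚ.+-identityʳ N))))

  extensions-contains : ∀ {n} (e : Vec ℕ n) → Contains R₁ R₂ R₃ e → extensions e ≃ # 0
  extensions-contains e c = mk λ N k → trans (vanish e c N k) (sym (#0≋0ₛ N k))
    where
    vanish : ∀ {n} (e : Vec ℕ n) → Contains R₁ R₂ R₃ e → ∀ N k → extensions e N k ≡ + 0
    vanish e c zero    k =
      cong (λ l → + length (filter (λ e → dist e ℕ.≟ k) l)) (Listₚ.filter-reject avoids? {xs = []} (λ a → a c))
    vanish {n} e c (suc N) k = sumOver-0 (upTo (suc n)) _ λ v →
      vanish (e ∷ʳ v) (from (contains-∷ʳ e v) (inj₁ c)) N k

  extensions-avoids : ∀ {n} (e : Vec ℕ n) → Avoids e →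
    extensions e ≃ t ^ₛ dist e ⊕ z ⊛ Σ< (suc n) (λ v → extensions (e ∷ʳ v))
  extensions-avoids {n} e a = mk eq
    where
    rest : Series
    rest = Σ< (suc n) (λ v → extensions (e ∷ʳ v))
    count : ∀ k → + length (filter (λ e → dist e ℕ.≟ k) (e ∷ [])) ≡ (t ^ₛ dist e) 0 k
    count k rewrite t^-zero (dist e) k with dist e ℕ.≡ᵇ k
    ... | true  = refl
    ... | false = refl
    eq : extensions e ≋ t ^ₛ dist e ⊕ z ⊛ rest
    eq zero    k = trans (cong (λ l → + length (filter (λ e → dist e ℕ.≟ k) l)) (Listₚ.filter-accept avoids? {xs = []} a))
      (trans (count k) (sym (trans (cong₂ ℤ._+_ (refl {x = (t ^ₛ dist e) 0 k}) (z-⊛-zero rest k)) (ℤₚ.+-identityʳ _))))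
    eq (suc N) k = trans (sumOver-upTo (suc n) (λ v → extensions (e ∷ʳ v)) N k)
      (sym (trans (cong₂ ℤ._+_ (t^-suc (dist e) N k) (z-⊛-suc rest N k)) (ℤₚ.+-identityˡ _)))

  -- `M` is Boolean because weights and products compute with it; `F` is a mere predicate because
  -- only its truth matters.
  record Represents {n} (e : Vec ℕ n) (M : ℕ → Bool) (F : ℕ → Set) : Set where
    field
      avoids    : Avoids e
      visited   : ∀ x → Visited e x ⇔ M x ≡ true
      forbidden : ∀ u → Forbidden e u ⇔ F u
  open Represents

  -- φ is c times the generating function of the avoiding continuations of e, up to the order zᴺ; it depends on
  -- e only through n, M and F.
  record Valued (c : Series) (N n : ℕ) (M : ℕ → Bool) (F : ℕ → Set) (φ : Series) : Set where
    constructor valued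
    field
      agrees : (e : Vec ℕ n) → Represents e M F → AgreeBelow N (c ⊛ extensions e) (t ^ₛ dist e ⊛ φ)
  open Valued public

  -- The weight of v appears here because the value of a state leaves out the factor `t ^ₛ dist e`
  -- of the word.
  data Child (c : Series) (N n : ℕ) (M : ℕ → Bool) (F : ℕ → Set) (v : ℕ) (x : Series) : Set₁ where
    forbid : F v → x ≃ # 0 → Child c N n M F v x
    allow  : ∀ {ψ} → ¬ F v → Valued c N (suc n) (M ∪ v) (Extension R₁ R₂ R₃ M F v) ψ →
             x ≃ weight (M v) ⊛ ψ → Child c N n M F v x

  ∪-true : ∀ M v x → (M ∪ v) x ≡ true ⇔ (M x ≡ true ⊎ x ≡ v)
  ∪-true M v x = mk⇔ split join
    where
    split : (M ∪ v) x ≡ true → M x ≡ true ⊎ x ≡ v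
    split p with M x
    ... | true  = inj₁ refl
    ... | false = inj₂ (ℕₚ.≡ᵇ⇒≡ x v (subst (λ b → T b) (sym p) _))
    join : M x ≡ true ⊎ x ≡ v → (M ∪ v) x ≡ true
    join (inj₁ p) rewrite p = refl
    join (inj₂ refl) = trans (cong (M x ∨_) (≡ᵇ-refl x)) (∨-zeroʳ (M x))

  represents-∷ʳ : ∀ {n} {e : Vec ℕ n} {M F} v → Represents e M F → ¬ F v →
    Represents (e ∷ʳ v) (M ∪ v) (Extension R₁ R₂ R₃ M F v)
  represents-∷ʳ {e = e} {M} v rep ok .avoids c with to (contains-∷ʳ e v) c
  ... | inj₁ old = rep .avoids old
  ... | inj₂ new = ok (to (rep .forbidden v) new)
  represents-∷ʳ {e = e} {M} v rep ok .visited x = mk⇔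
    (λ p → from (∪-true M v x) ([ inj₁ ∘ to (rep .visited x) , inj₂ ]′ (to (visited-∷ʳ e v x) p)))
    (λ p → from (visited-∷ʳ e v x) ([ inj₁ ∘ from (rep .visited x) , inj₂ ]′ (to (∪-true M v x) p)))
  represents-∷ʳ {e = e} {M} v rep ok .forbidden u = mk⇔
    (λ p → [ before ∘ to (rep .forbidden u)
           , (λ (x , m , r₁ , r₂ , r₃) → now x (to (rep .visited x) m) r₁ r₂ r₃) ]′ (to (forbidden-∷ʳ e v u) p))
    (λ where
      (before f)         → from (forbidden-∷ʳ e v u) (inj₁ (from (rep .forbidden u) f))
      (now x m r₁ r₂ r₃) → from (forbidden-∷ʳ e v u) (inj₂ (x , from (rep .visited x) m , r₁ , r₂ , r₃)))

  dist-∷ʳ : ∀ {n} {e : Vec ℕ n} {M F} v → Represents e M F → t ^ₛ dist (e ∷ʳ v) ≃ t ^ₛ dist e ⊛ weight (M v)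
  dist-∷ʳ {e = e} {M} v rep with M v in Mv
  ... | true  = ≃-trans (≃-reflexive (cong (t ^ₛ_) (dist-old e v (from (rep .visited v) Mv))))
    (solve 1 (λ a → a := a :* con (+ 1)) ≃-refl (t ^ₛ dist e))
  ... | false = ≃-trans (≃-reflexive (cong (t ^ₛ_) (dist-new e v (λ old → contradiction (trans (sym (to (rep .visited v) old)) Mv) λ ()))))
    (solve 2 (λ a b → a :* b := b :* a) ≃-refl t (t ^ₛ dist e))

  -- This is the uniqueness argument. The guess φ satisfies the same equation as c times the
  -- generating function, and the z in front of the children raises agreement from order N to order
  -- N + 1. Every guess below is checked by this step, with nothing to prove at order 0.
  valued-suc : ∀ {c N n M F φ X} → Sums (Child c N n M F) (suc n) X → φ ≃ c ⊕ z ⊛ X → Valued c (suc N) n M F φ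
  valued-suc {c} {N} {n} {M} {F} {φ} {X} children φ≃ = valued agrees′
    where
    agrees′ : (e : Vec ℕ n) → Represents e M F → AgreeBelow (suc N) (c ⊛ extensions e) (t ^ₛ dist e ⊛ φ)
    agrees′ e rep = agree-≃ lhs rhs (agree-⊕ {f = c ⊛ d} {c ⊛ d} (λ _ _ _ → refl) (agree-z⊛ (sums children)))
      where
      d : Series
      d = t ^ₛ dist e
      sums : ∀ {j X} → Sums (Child c N n M F) j X →
             AgreeBelow N (Σ< j (λ v → c ⊛ extensions (e ∷ʳ v))) (d ⊛ X)
      child : ∀ {v x} → Child c N n M F v x → AgreeBelow N (c ⊛ extensions (e ∷ʳ v)) (d ⊛ x)
      child {v} {x} (forbid f x≃0) = agree-≃
        (≃-trans (⊛-congˡ c (extensions-contains (e ∷ʳ v) (from (contains-∷ʳ e v) (inj₂ (from (rep .forbidden v) f)))))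
          (solve 1 (λ c → c :* con (+ 0) := con (+ 0)) ≃-refl c))
        (≃-trans (⊛-congˡ d x≃0) (solve 1 (λ c → c :* con (+ 0) := con (+ 0)) ≃-refl d))
        (λ _ _ _ → refl)
      child {v} {x} (allow {ψ} ok val x≃) = agree-≃ ≃-refl
        (≃-trans (⊛-congˡ d x≃) (≃-trans
          (solve 3 (λ a b c → a :* (b :* c) := (a :* b) :* c) ≃-refl d (weight (M v)) ψ)
          (⊛-congʳ ψ (≃-sym (dist-∷ʳ v rep)))))
        (val .agrees (e ∷ʳ v) (represents-∷ʳ v rep ok))
      sums ([] X≃0) = agree-≃ {f = # 0} ≃-refl
        (≃-trans (⊛-congˡ d X≃0) (solve 1 (λ c → c :* con (+ 0) := con (+ 0)) ≃-refl d)) (λ _ _ _ → refl)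
      sums (_∷ʳ_≈_ {A = A} {x} xs p X≃) = agree-≃ ≃-refl
        (≃-trans (⊛-congˡ d X≃) (solve 3 (λ a b c → a :* (b :+ c) := a :* b :+ a :* c) ≃-refl d A x))
        (agree-⊕ (sums xs) (child p))
      lhs : c ⊛ extensions e ≃ c ⊛ d ⊕ z ⊛ Σ< (suc n) (λ v → c ⊛ extensions (e ∷ʳ v))
      lhs = ≃-trans (⊛-congˡ c (extensions-avoids e (rep .avoids))) (≃-trans
        (solve 4 (λ c d z s → c :* (d :+ z :* s) := c :* d :+ z :* (c :* s)) ≃-refl c d z (Σ< (suc n) (λ v → extensions (e ∷ʳ v))))
        (⊕-congˡ (c ⊛ d) (⊛-congˡ z (Σ<-⊛ c (suc n) (λ v → extensions (e ∷ʳ v))))))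
      rhs : d ⊛ φ ≃ c ⊛ d ⊕ z ⊛ (d ⊛ X)
      rhs = ≃-trans (⊛-congˡ d φ≃) (solve 4 (λ c d z x → d :* (c :+ z :* x) := c :* d :+ z :* (d :* x)) ≃-refl c d z X)

  valued-resp : ∀ {c N n M M′ F F′ φ} → (∀ x → M x ≡ M′ x) → (∀ u → F u ⇔ F′ u) →
    Valued c N n M F φ → Valued c N n M′ F′ φ
  valued-resp M≗ F⇔ val = valued λ e rep → val .agrees e record
    { avoids    = rep .avoids
    ; visited   = λ x → subst (λ b → Visited e x ⇔ b ≡ true) (sym (M≗ x)) (rep .visited x)
    ; forbidden = λ u → mk⇔ (from (F⇔ u) ∘ to (rep .forbidden u)) (from (rep .forbidden u) ∘ to (F⇔ u))
    }

  Igf-valued : ∀ {c φ} → (∀ N → Valued c N 0 (λ _ → false) (λ _ → ⊥) φ) → c ⊛ Igf R₁ R₂ R₃ ≃ φ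
  Igf-valued {c} {φ} val = mk λ N k → agree-≃ (⊛-congˡ c Igf≃extensions)
    (solve 1 (λ φ → φ := con (+ 1) :* φ) ≃-refl φ)
    (val (suc N) .agrees [] record
      { avoids    = λ { (() , _) }
      ; visited   = λ x → mk⇔ (λ { (() , _) }) (λ ())
      ; forbidden = λ u → mk⇔ (λ { (() , _) }) (λ ())
      }) N ℕₚ.≤-refl k

-- Geometric series, constant phases and decreasing phases

abstract
  -- The series 1/(1 - z b), obtained as a fixed point with vanishing quadratic term. It is kept
  -- opaque, as only its equation is used.
  geometric : Series → Series
  geometric b = Quadratic.solution (# 1) b (# 0)

  geometric-eq : ∀ b → geometric b ≃ # 1 ⊕ z ⊛ (b ⊛ geometric b)
  geometric-eq b = ≃-trans (Quadratic.solution-eq (# 1) b (# 0))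
    (solve 3 (λ z b g → con (+ 1) :+ z :* (b :* g :+ con (+ 0) :* (g :* g)) := con (+ 1) :+ z :* (b :* g))
      ≃-refl z b (geometric b))

G : Series
G = geometric (# 1)

G-eq : G ≃ # 1 ⊕ z ⊛ G
G-eq = ≃-trans (geometric-eq (# 1))
  (solve 2 (λ z g → con (+ 1) :+ z :* (con (+ 1) :* g) := con (+ 1) :+ z :* g) ≃-refl z G)

∪-absorb : ∀ M v → M v ≡ true → ∀ x → (M ∪ v) x ≡ M x
∪-absorb M v Mv x with M x in Mx
... | true  = refl
... | false with x ℕ.≡ᵇ v in x≡v
...   | false = refl
...   | true with refl ← ℕₚ.≡ᵇ⇒≡ x v (subst T (sym x≡v) tt) = trans (sym Mv) Mx

≢⇒≡ᵇ-false : ∀ {x v} → x ≢ v → (x ℕ.≡ᵇ v) ≡ false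
≢⇒≡ᵇ-false {x} {v} x≢v with x ℕ.≡ᵇ v in eq
... | false = refl
... | true  = contradiction (ℕₚ.≡ᵇ⇒≡ x v (subst T (sym eq) tt)) x≢v

∪-other : ∀ M v {x} → x ≢ v → (M ∪ v) x ≡ M x
∪-other M v {x} x≢v = trans (cong (M x ∨_) (≢⇒≡ᵇ-false x≢v)) (∨-identityʳ (M x))

∪-self : ∀ M v → (M ∪ v) v ≡ true
∪-self M v = trans (cong (M v ∨_) (≡ᵇ-refl v)) (∨-zeroʳ (M v))

∪-mono : ∀ M v {x} → M x ≡ true → (M ∪ v) x ≡ true
∪-mono M v p rewrite p = refl

-- For a word of length v + 1 + o the next letter is one of v smaller letters, v itself, or one of o
-- + 1 larger letters.
Sums-split : ∀ {P : ℕ → Series → Set₁} v o {A x B} → Sums P v A → P v x →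
  Sums (λ j → P (suc v ℕ.+ j)) (suc o) B → Sums P (suc (suc v ℕ.+ o)) (A ⊕ x ⊕ B)
Sums-split {P} v o {A} {x} {B} below here above = subst (λ j → Sums P j (A ⊕ x ⊕ B)) (ℕₚ.+-suc (suc v) o)
  (Sums-++ (suc v) (below ∷ʳ here ≈ ≃-refl) above)

prod : (Bool → Series) → (ℕ → Bool) → ℕ → Series
prod p M zero    = # 1
prod p M (suc u) = prod p M u ⊛ p (M u)

prod-cong : ∀ p {M M′} u → (∀ x → x < u → M x ≡ M′ x) → prod p M u ≡ prod p M′ u
prod-cong p zero    M≗ = refl
prod-cong p (suc u) M≗ = cong₂ (λ f b → f ⊛ p b)
  (prod-cong p u (λ x x<u → M≗ x (ℕₚ.m≤n⇒m≤1+n x<u))) (M≗ u ℕₚ.≤-refl)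

prod-∪ : ∀ p M v → prod p (M ∪ v) v ≡ prod p M v
prod-∪ p M v = prod-cong p v (λ x x<v → ∪-other M v (ℕₚ.<⇒≢ x<v))

module Words (c : Series) (R₁ R₂ R₃ : Rel) where
  open Counting R₁ R₂ R₃ public

  Val : (N n : ℕ) → (ℕ → Bool) → (ℕ → Set) → Series → Set
  Val = Valued c

  Ch : (N n : ℕ) → (ℕ → Bool) → (ℕ → Set) → ℕ → Series → Set₁
  Ch = Child c

  Ext : (ℕ → Bool) → (ℕ → Set) → ℕ → ℕ → Set
  Ext = Extension R₁ R₂ R₃

  valued-zero : ∀ {n M F φ} → Val 0 n M F φ
  valued-zero = valued λ e rep n ()

  valued-≃ : ∀ {N n M F φ ψ} → φ ≃ ψ → Val N n M F φ → Val N n M F ψ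
  valued-≃ φ≃ψ val = valued λ e rep → agree-≃ ≃-refl (⊛-congˡ (t ^ₛ dist e) (≃-sym φ≃ψ)) (val .agrees e rep)

  enter : ∀ {N n M M′ F F′ v ψ} → ¬ F v → (∀ x → M′ x ≡ (M ∪ v) x) → (∀ w → F′ w ⇔ Ext M F v w) →
    Val N (suc n) M′ F′ ψ → Ch N n M F v (weight (M v) ⊛ ψ)
  enter ok M≗ F⇔ val = allow ok (valued-resp M≗ F⇔ val) ≃-refl

  enter-free : ∀ {N n M M′ v ψ} → (∀ x → M′ x ≡ (M ∪ v) x) → (∀ x → M x ≡ true → ¬ ⟦ R₁ ⟧ x v) →
    Val N (suc n) M′ (λ _ → ⊥) ψ → Ch N n M (λ _ → ⊥) v (weight (M v) ⊛ ψ)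
  enter-free M≗ inactive = enter id M≗ λ w → mk⇔ ⊥-elim λ { (now x Mx r _ _) → inactive x Mx r }

  forbid-all : ∀ {N n M F} m o → (∀ v → m ≤ v → F v) → Sums (λ j → Ch N n M F (m ℕ.+ j)) o (# 0)
  forbid-all m zero    all = [] ≃-refl
  forbid-all m (suc o) all =
    forbid-all m o all ∷ʳ forbid (all (m ℕ.+ o) (ℕₚ.m≤m+n m o)) ≃-refl ≈
    solve 0 (con (+ 0) := con (+ 0) :+ con (+ 0)) ≃-refl

  -- Only v may follow, so the continuations are runs of v, counted by `G` = 1/(1 - z). The
  -- hypothesis `sound` says that repeating v never forbids v itself.
  stay : ∀ N n {M} v → v < n → M v ≡ true → (∀ w → Ext M (v ≢_) v w → v ≢ w) → Val N n M (v ≢_) (c ⊛ G)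
  stay zero    n v v<n Mv sound = valued-zero
  stay (suc N) n {M} v v<n Mv sound with ℕₚ.m≤n⇒∃[o]m+o≡n v<n
  ... | o , refl = valued-suc
    (Sums-split v o
        (Sums-tabulate v (λ _ → # 0) (λ u u<v → forbid (ℕₚ.<⇒≢ u<v ∘ sym) ≃-refl))
        (enter {F′ = v ≢_} (λ v≢v → v≢v refl) (λ x → sym (∪-absorb M v Mv x)) (λ w → mk⇔ before (sound w))
          (stay N (suc n) v (ℕₚ.m≤n⇒m≤1+n v<n) Mv sound))
        (forbid-all (suc v) (suc o) (λ u v<u → ℕₚ.<⇒≢ v<u)))
    (≃-trans (⊛-congˡ c G-eq) (≃-trans
      (solve 3 (λ c z g → c :* (con (+ 1) :+ z :* g) := c :+ z :* (con (+ 0) :+ con (+ 1) :* (c :* g) :+ con (+ 0))) ≃-refl c z G)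
      (⊕-congˡ c (⊛-congˡ z (⊕-congʳ (# 0) (⊕-cong (Σ0 v) (≃-reflexive (cong (λ b → weight b ⊛ (c ⊛ G)) (sym Mv)))))))))
    where
    Σ0 : ∀ v → # 0 ≃ Σ< v (λ _ → # 0)
    Σ0 zero    = ≃-refl
    Σ0 (suc v) = ≃-trans (solve 0 (con (+ 0) := con (+ 0) :+ con (+ 0)) ≃-refl) (⊕-congʳ (# 0) (Σ0 v))

  -- Phases in which the letters decrease: ⟦ Rt ⟧ v w means that w cannot occur after v.  Each letter u < v
  -- contributes independently, whence a product.
  module Decreasing (Rt : Rel)
    (down : ∀ {u v w} → u ≤ v → ⟦ Rt ⟧ v w → ⟦ Rt ⟧ u w)
    (<⇒Rt : ∀ {v w} → v < w → ⟦ Rt ⟧ v w)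
    (Rt⇒≤ : ∀ {v w} → ⟦ Rt ⟧ v w → v ≤ w)
    -- κ counts what may follow a letter within its own run: 1/(1 - z) if the letter may be
    -- repeated, 1 if it may not.
    (κ : Series)
    (diagonal : (∀ v → ¬ ⟦ Rt ⟧ v v) × κ ≃ # 1 ⊕ z ⊛ κ ⊎ (∀ v → ⟦ Rt ⟧ v v) × κ ≃ # 1)
    where

    -- The factor of one smaller letter: it is either omitted or used in one nonempty run.
    p : Bool → Series
    p b = # 1 ⊕ z ⊛ (weight b ⊛ κ)

    value : (ℕ → Bool) → ℕ → Series
    value M v = c ⊛ (κ ⊛ prod p M v)

    -- Expanding the product, the nonempty selections of letters below u are sorted by their largest
    -- letter.
    telescope : ∀ M u → z ⊛ Σ< u (λ v → weight (M v) ⊛ value M v) ≃ c ⊛ (prod p M u ⊝ # 1)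
    telescope M zero    = solve 2 (λ c z → z :* con (+ 0) := c :* (con (+ 1) :- con (+ 1))) ≃-refl c z
    telescope M (suc u) = ≃-trans
      (solve 3 (λ z s x → z :* (s :+ x) := z :* s :+ z :* x) ≃-refl z (Σ< u (λ v → weight (M v) ⊛ value M v)) (weight (M u) ⊛ value M u))
      (≃-trans (⊕-congʳ (z ⊛ (weight (M u) ⊛ value M u)) (telescope M u))
        (solve 5 (λ c z w k P → c :* (P :- con (+ 1)) :+ z :* (w :* (c :* (k :* P)))
           := c :* (P :* (con (+ 1) :+ z :* (w :* k)) :- con (+ 1))) ≃-refl c z (weight (M u)) κ (prod p M u)))

    -- Together the fields say that a letter u ≤ v, once appended, newly forbids exactly the letters
    -- in relation `Rt` to it: `sound` bounds what becomes forbidden, and `complete` finds a seen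
    -- letter as first letter of the pattern.
    record Active (M : ℕ → Bool) (v : ℕ) : Set where
      field
        sound    : ∀ {x u w} → u ≤ v → ⟦ R₁ ⟧ x u → ⟦ R₂ ⟧ u w → ⟦ R₃ ⟧ x w → ⟦ Rt ⟧ u w
        complete : ∀ {u w} → u ≤ v → ⟦ Rt ⟧ u w → ∃ λ x → M x ≡ true × ⟦ R₁ ⟧ x u × ⟦ R₂ ⟧ u w × ⟦ R₃ ⟧ x w
    open Active

    active-↓ : ∀ {M u v} → u ≤ v → Active M v → Active (M ∪ u) u
    active-↓ u≤v act .sound    u′≤u = act .sound (ℕₚ.≤-trans u′≤u u≤v)
    active-↓ {M} {u} u≤v act .complete u′≤u rt with act .complete (ℕₚ.≤-trans u′≤u u≤v) rt
    ... | x , Mx , r = x , ∪-mono M u Mx , r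

    decreasing : ∀ N n {M} v → v < n → M v ≡ true → Active M v → Val N n M (⟦ Rt ⟧ v) (value M v)

    -- The witnesses for v itself must come from `M`, before v is appended, whereas those for later
    -- letters may include v; hence the separate hypothesis besides activity of `M ∪ v`.
    enter-decreasing : ∀ N n {M F} v → v ≤ n → ¬ F v → (∀ w → F w → ⟦ Rt ⟧ v w) → Active (M ∪ v) v →
      (∀ {w} → ⟦ Rt ⟧ v w → ∃ λ x → M x ≡ true × ⟦ R₁ ⟧ x v × ⟦ R₂ ⟧ v w × ⟦ R₃ ⟧ x w) →
      Ch N n M F v (weight (M v) ⊛ value M v)
    enter-decreasing N n {M} {F} v v≤n ok F⇒Rt act comp = enter ok (λ _ → refl)
      (λ w → mk⇔
        (λ rt → let (x , Mx , r₁ , r₂ , r₃) = comp rt in now x Mx r₁ r₂ r₃)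
        (λ { (before f) → F⇒Rt w f ; (now x _ r₁ r₂ r₃) → act .sound ℕₚ.≤-refl r₁ r₂ r₃ }))
      (valued-≃ (≃-reflexive (cong (λ P → c ⊛ (κ ⊛ P)) (prod-∪ p M v)))
        (decreasing N (suc n) v (s≤s v≤n) (∪-self M v) act))

    enter-active : ∀ N n {M F} v → v ≤ n → ¬ F v → (∀ w → F w → ⟦ Rt ⟧ v w) → Active M v →
      Ch N n M F v (weight (M v) ⊛ value M v)
    enter-active N n v v≤n ok F⇒Rt act =
      enter-decreasing N n v v≤n ok F⇒Rt (active-↓ ℕₚ.≤-refl act) (act .complete ℕₚ.≤-refl)

    active-≤ : ∀ {M u v} → u ≤ v → Active M v → Active M u
    active-≤ u≤v act .sound    u′≤u = act .sound (ℕₚ.≤-trans u′≤u u≤v)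
    active-≤ u≤v act .complete u′≤u = act .complete (ℕₚ.≤-trans u′≤u u≤v)

    decreasing zero    n v v<n Mv act = valued-zero
    decreasing (suc N) n {M} v v<n Mv act with ℕₚ.m≤n⇒∃[o]m+o≡n v<n
    ... | o , refl = [ weak , strict ]′ diagonal
      where
      below : Sums (Ch N n M (⟦ Rt ⟧ v)) v (Σ< v (λ u → weight (M u) ⊛ value M u))
      below = Sums-tabulate v _ λ u u<v → enter-active N n u (ℕₚ.<⇒≤ (ℕₚ.<-trans u<v v<n))
        (ℕₚ.<⇒≱ u<v ∘ Rt⇒≤) (λ w → down (ℕₚ.<⇒≤ u<v)) (active-≤ (ℕₚ.<⇒≤ u<v) act)
      all : ∀ {x} → Ch N n M (⟦ Rt ⟧ v) v x → Sums (Ch N n M (⟦ Rt ⟧ v)) (suc n)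
        (Σ< v (λ u → weight (M u) ⊛ value M u) ⊕ x ⊕ # 0)
      all here = Sums-split v o below here (forbid-all (suc v) (suc o) (λ u → <⇒Rt))
      P Σ : Series
      P = prod p M v
      Σ = Σ< v (λ u → weight (M u) ⊛ value M u)
      weak : (∀ v → ¬ ⟦ Rt ⟧ v v) × κ ≃ # 1 ⊕ z ⊛ κ → Val (suc N) n M (⟦ Rt ⟧ v) (value M v)
      weak (irr , κ-eq) = valued-suc
        (all (enter {F′ = ⟦ Rt ⟧ v} (irr v) (λ x → sym (∪-absorb M v Mv x))
          (λ w → mk⇔ before (λ { (before f) → f ; (now x _ r₁ r₂ r₃) → act .sound ℕₚ.≤-refl r₁ r₂ r₃ }))
          (decreasing N (suc n) v (ℕₚ.m≤n⇒m≤1+n v<n) Mv act)))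
        (≃-trans (⊛-congˡ c (⊛-congʳ P κ-eq)) (≃-trans
          (solve 4 (λ c z k P → c :* ((con (+ 1) :+ z :* k) :* P)
             := c :+ (c :* (P :- con (+ 1)) :+ z :* (con (+ 1) :* (c :* (k :* P))))) ≃-refl c z κ P)
          (⊕-congˡ c (≃-trans (⊕-cong (≃-sym (telescope M v)) (≃-reflexive (cong (λ b → z ⊛ (weight b ⊛ value M v)) (sym Mv))))
            (solve 3 (λ z s x → z :* s :+ z :* x := z :* (s :+ x :+ con (+ 0))) ≃-refl z Σ (weight (M v) ⊛ value M v))))))
      strict : (∀ v → ⟦ Rt ⟧ v v) × κ ≃ # 1 → Val (suc N) n M (⟦ Rt ⟧ v) (value M v)
      strict (rfl , κ-eq) = valued-suc (all (forbid (rfl v) ≃-refl))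
        (≃-trans (⊛-congˡ c (⊛-congʳ P κ-eq)) (≃-trans
          (solve 2 (λ c P → c :* (con (+ 1) :* P) := c :+ c :* (P :- con (+ 1))) ≃-refl c P)
          (⊕-congˡ c (≃-trans (≃-sym (telescope M v))
            (solve 2 (λ z s → z :* s := z :* (s :+ con (+ 0) :+ con (+ 0))) ≃-refl z Σ)))))

-- The cofactors k, l, m of the vanishing series turn an equation that holds modulo relations into a polynomial
-- identity for the ring solver.
modulo₁ : ∀ {f g} k {e} → e ≃ # 0 → f ≃ g ⊕ k ⊛ e → f ≃ g
modulo₁ {f} {g} k {e} e≃0 f≃ = ≃-trans f≃ (≃-trans (⊕-congˡ g (⊛-congˡ k e≃0))
  (solve 2 (λ g k → g :+ k :* con (+ 0) := g) ≃-refl g k))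

≃⇒⊝≃0 : ∀ {f g} → f ≃ g → f ⊝ g ≃ # 0
≃⇒⊝≃0 {f} {g} f≃g = ≃-trans (⊕-congʳ (⊝ g) f≃g) (solve 1 (λ g → g :- g := con (+ 0)) ≃-refl g)

modulo₂ : ∀ {f g} k {e} l {d} → e ≃ # 0 → d ≃ # 0 → f ≃ g ⊕ k ⊛ e ⊕ l ⊛ d → f ≃ g
modulo₂ k l e≃0 d≃0 f≃ = modulo₁ k e≃0 (modulo₁ l d≃0 f≃)

modulo₃ : ∀ {f g} k {e} l {d} m {b} → e ≃ # 0 → d ≃ # 0 → b ≃ # 0 →
  f ≃ g ⊕ k ⊛ e ⊕ l ⊛ d ⊕ m ⊛ b → f ≃ g
modulo₃ k l m e≃0 d≃0 b≃0 f≃ = modulo₂ k l e≃0 d≃0 (modulo₁ m b≃0 f≃)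

-- Patterns whose words begin as a staircase 0, 1, ..., a - 1

stair : ℕ → ℕ → Bool
stair a x = x ℕ.<ᵇ a

stair-true : ∀ {x a} → x < a → stair a x ≡ true
stair-true {x} {a} x<a with x ℕ.<ᵇ a in eq
... | true  = refl
... | false = contradiction (subst T eq (ℕₚ.<⇒<ᵇ x<a)) id

stair⇒< : ∀ {x a} → stair a x ≡ true → x < a
stair⇒< {x} {a} p = ℕₚ.<ᵇ⇒< x a (subst T (sym p) tt)

stair-self : ∀ a → stair a a ≡ false
stair-self zero    = refl
stair-self (suc a) = stair-self a

stair-∪ : ∀ a x → stair (suc a) x ≡ (stair a ∪ a) x
stair-∪ zero    zero    = refl
stair-∪ zero    (suc x) = refl
stair-∪ (suc a) zero    = refl
stair-∪ (suc a) (suc x) = stair-∪ a x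

prod-true : ∀ p {M} u → (∀ x → x < u → M x ≡ true) → prod p M u ≃ p true ^ₛ u
prod-true p zero    M≡ = ≃-refl
prod-true p {M} (suc u) M≡ = ≃-trans
  (⊛-congʳ (p (M u)) (prod-true p u (λ x x<u → M≡ x (ℕₚ.m≤n⇒m≤1+n x<u))))
  (≃-trans (≃-reflexive (cong (λ b → p true ^ₛ u ⊛ p b) (M≡ u ℕₚ.≤-refl)))
    (solve 2 (λ a b → a :* b := b :* a) ≃-refl (p true ^ₛ u) (p true)))

#-suc : ∀ a → # (suc a) ≃ # 1 ⊕ # a
#-suc a = mk (cst-+ (+ 1) (+ a))

Σ<-const : ∀ n f → Σ< n (λ _ → f) ≃ # n ⊛ f
Σ<-const zero    f = solve 1 (λ f → con (+ 0) := con (+ 0) :* f) ≃-refl f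
Σ<-const (suc n) f = ≃-trans (⊕-congʳ f (Σ<-const n f)) (≃-trans
  (solve 2 (λ n f → n :* f :+ f := (con (+ 1) :+ n) :* f) ≃-refl (# n) f) (⊛-congʳ f (≃-sym (#-suc n))))

Σ<-cong : ∀ n {f g} → (∀ v → v < n → f v ≃ g v) → Σ< n f ≃ Σ< n g
Σ<-cong zero    p = ≃-refl
Σ<-cong (suc n) p = ⊕-cong (Σ<-cong n (λ v v<n → p v (ℕₚ.m≤n⇒m≤1+n v<n))) (p n ℕₚ.≤-refl)

module Staircase (c : Series) (R₁ R₂ R₃ : Rel) (inactive : ∀ {x a} → x < a → ¬ ⟦ R₁ ⟧ x a) where
  open Words c R₁ R₂ R₃ public

  -- The word has length a and contains all letters below a, so a is both the largest possible next
  -- letter and the only new one.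
  stair-suc : ∀ {N a φ ψ X} → Sums (Ch N a (stair a) (λ _ → ⊥)) a X →
    Val N (suc a) (stair (suc a)) (λ _ → ⊥) ψ → φ ≃ c ⊕ z ⊛ (X ⊕ t ⊛ ψ) →
    Val (suc N) a (stair a) (λ _ → ⊥) φ
  stair-suc {a = a} {ψ = ψ} {X} below next φ≃ = valued-suc
    (below ∷ʳ enter-free (stair-∪ a) (λ x x∈ → inactive (stair⇒< x∈)) next
       ≈ ⊕-congˡ X (≃-reflexive (cong (λ b → weight b ⊛ ψ) (sym (stair-self a)))))
    φ≃

module StaircaseDecreasing (c : Series) (R Rt : Rel) (inactive : ∀ {x a} → x < a → ¬ ⟦ R ⟧ x a)
    (reflexive : ∀ x → ⟦ R ⟧ x x)
    (down : ∀ {u v w} → u ≤ v → ⟦ Rt ⟧ v w → ⟦ Rt ⟧ u w)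
    (<⇒Rt : ∀ {v w} → v < w → ⟦ Rt ⟧ v w)
    (Rt⇒≤ : ∀ {v w} → ⟦ Rt ⟧ v w → v ≤ w)
    (κ : Series)
    (diagonal : (∀ v → ¬ ⟦ Rt ⟧ v v) × κ ≃ # 1 ⊕ z ⊛ κ ⊎ (∀ v → ⟦ Rt ⟧ v v) × κ ≃ # 1)
    -- That is, β = c / (1 - z t q) with q = 1 + z κ.
    (β : Series) (β-eq : β ≃ c ⊕ z ⊛ (t ⊛ (β ⊛ (# 1 ⊕ z ⊛ (# 1 ⊛ κ)))))
    where
  open Staircase c R Rt -r inactive
  open Decreasing Rt down <⇒Rt Rt⇒≤ κ diagonal

  q : Series
  q = p true

  active : ∀ {a v} → v < a → Active (stair a) v
  active v<a = record
    { sound    = λ _ _ rt _ → rt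
    ; complete = λ {u} u≤v rt → u , stair-true (ℕₚ.≤-<-trans u≤v v<a) , reflexive u , rt , tt
    }

  -- All smaller letters have been seen, so the decreasing phases telescope to c (q^a - 1). Together
  -- with the c of the word itself this is a multiple of q^a, and cancelling q^a leaves `β-eq`.
  head : ∀ N a → Val N a (stair a) (λ _ → ⊥) (β ⊛ q ^ₛ a)
  head zero    a = valued-zero
  head (suc N) a = stair-suc
    (Sums-tabulate a _ λ u u<a → enter-active N a u (ℕₚ.<⇒≤ u<a) id (λ _ ()) (active u<a))
    (head N (suc a))
    (≃-trans (⊛-congʳ Q β-eq) (≃-trans
      (solve 6 (λ c z t β q Q → (c :+ z :* (t :* (β :* q))) :* Q
        := c :+ (c :* (Q :- con (+ 1)) :+ z :* (t :* (β :* (q :* Q))))) ≃-refl c z t β q Q)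
      (⊕-congˡ c (≃-trans
        (⊕-congʳ (z ⊛ (t ⊛ (β ⊛ (q ⊛ Q)))) (≃-trans
          (⊛-congˡ c (⊕-congʳ (⊝ # 1) (≃-sym (prod-true p a (λ x → stair-true)))))
          (≃-sym (telescope (stair a) a))))
        (solve 3 (λ z s x → z :* s :+ z :* x := z :* (s :+ x)) ≃-refl z
          (Σ< a (λ u → weight (stair a u) ⊛ value (stair a) u)) (t ⊛ (β ⊛ (q ⊛ Q))))))))
    where
    Q : Series
    Q = q ^ₛ a

  result : c ⊛ Igf R Rt -r ≃ β
  result = ≃-trans (Igf-valued (λ N → head N 0)) (solve 1 (λ β → β :* con (+ 1) := β) ≃-refl β)

G-inverse : (# 1 ⊝ z) ⊛ G ⊝ # 1 ≃ # 0
G-inverse = ≃-trans (solve 2 (λ z g → (con (+ 1) :- z) :* g :- con (+ 1) := g :- (con (+ 1) :+ z :* g)) ≃-refl z G) (≃⇒⊝≃0 G-eq)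

=-< : (# 1 ⊝ z ⊝ z ⊛ t) ⊛ Igf =r <r -r ≃ # 1 ⊝ z
=-< = StaircaseDecreasing.result (# 1 ⊝ z ⊝ z ⊛ t) =r <r ℕₚ.<⇒≢ (λ _ → refl)
  ℕₚ.≤-<-trans id ℕₚ.<⇒≤ G (inj₁ ((λ v → ℕₚ.<-irrefl refl) , G-eq)) (# 1 ⊝ z)
  (modulo₁ (⊝ (z ⊛ (z ⊛ t))) G-inverse
    (solve 3 (λ z t g → con (+ 1) :- z := con (+ 1) :- z :- z :* t :+
      z :* (t :* ((con (+ 1) :- z) :* (con (+ 1) :+ z :* (con (+ 1) :* g))))
      :+ (:- (z :* (z :* t))) :* ((con (+ 1) :- z) :* g :- con (+ 1))) ≃-refl z t G))

=-≤ : (# 1 ⊝ z ⊛ t ⊝ z ^ₛ 2 ⊛ t) ⊛ Igf =r ≤r -r ≃ # 1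
=-≤ = StaircaseDecreasing.result (# 1 ⊝ z ⊛ t ⊝ z ^ₛ 2 ⊛ t) =r ≤r ℕₚ.<⇒≢ (λ _ → refl)
  ℕₚ.≤-trans ℕₚ.<⇒≤ id (# 1) (inj₂ ((λ v → ℕₚ.≤-refl) , ≃-refl)) (# 1)
  (solve 2 (λ z t → con (+ 1) := con (+ 1) :- z :* t :- (z :* (z :* con (+ 1))) :* t :+
      z :* (t :* (con (+ 1) :* (con (+ 1) :+ z :* (con (+ 1) :* con (+ 1)))))) ≃-refl z t)

-- After a letter u < a only u may follow, so each of the a choices contributes c G and the value α
-- + a β is affine in a. Comparing coefficients gives β = z c G + z t β and α = c + z t (α + β).
≥-≠ : (# 1 ⊝ z) ⊛ (# 1 ⊝ z ⊛ t) ^ₛ 2 ⊛ Igf ≥r ≠r -r ≃ # 1 ⊝ z ⊝ z ⊛ t ⊕ # 2 ⊛ z ^ₛ 2 ⊛ t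
≥-≠ = ≃-trans (Igf-valued (λ N → head N 0)) (solve 2 (λ a b → a :+ con (+ 0) :* b := a) ≃-refl α β)
  where
  c α β : Series
  c = (# 1 ⊝ z) ⊛ (# 1 ⊝ z ⊛ t) ^ₛ 2
  α = # 1 ⊝ z ⊝ z ⊛ t ⊕ # 2 ⊛ z ^ₛ 2 ⊛ t
  β = z ⊛ (# 1 ⊝ z ⊛ t)
  open Staircase c ≥r ≠r -r ℕₚ.<⇒≱
  head : ∀ N a → Val N a (stair a) (λ _ → ⊥) (α ⊕ # a ⊛ β)
  head zero    a = valued-zero
  head (suc N) a = stair-suc
    (Sums-tabulate a (λ u → weight (stair a u) ⊛ (c ⊛ G)) λ u u<a →
      enter {F′ = u ≢_} id (λ x → sym (∪-absorb (stair a) u (stair-true u<a) x))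
        (λ w → mk⇔ (λ u≢w → now u (stair-true u<a) ℕₚ.≤-refl u≢w tt) (λ { (before ()) ; (now _ _ _ u≢w _) → u≢w }))
        (stay N (suc a) u (ℕₚ.m≤n⇒m≤1+n u<a) (stair-true u<a)
          (λ w → λ { (before u≢w) → u≢w ; (now _ _ _ u≢w _) → u≢w })))
    (head N (suc a))
    (≃-trans (modulo₁ (⊝ (# a ⊛ (z ⊛ (# 1 ⊝ z ⊛ t) ^ₛ 2))) G-inverse
      (solve 4 (λ z t g a →
         let c = (1′ :- z) :* (1′ :- z :* t) ^′ 2
             α = 1′ :- z :- z :* t :+ 2′ :* z ^′ 2 :* t
             β = z :* (1′ :- z :* t)
         in α :+ a :* β := c :+ z :* (a :* (c :* g) :+ t :* (α :+ (1′ :+ a) :* β))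
              :+ (:- (a :* (z :* (1′ :- z :* t) ^′ 2))) :* ((1′ :- z) :* g :- 1′)) ≃-refl z t G (# a)))
      (⊕-congˡ c (⊛-congˡ z (⊕-cong
        (≃-trans (≃-sym (Σ<-const a (c ⊛ G))) (Σ<-cong a λ u u<a → ≃-trans
          (solve 1 (λ x → x := 1′ :* x) ≃-refl (c ⊛ G))
          (≃-reflexive (cong (λ b → weight b ⊛ (c ⊛ G)) (sym (stair-true u<a))))))
        (⊛-congˡ t (⊕-congˡ α (⊛-congʳ β (≃-sym (#-suc a)))))))))

module StartAtOne (c : Series) (R₁ R₂ R₃ : Rel) where
  open Words c R₁ R₂ R₃

  -- The first letter is always 0, so the later phases may start from a nonempty word.
  from-one : ∀ {ψ} → (∀ N → Val N 1 (ℕ._≡ᵇ 0) (λ _ → ⊥) ψ) → c ⊛ Igf R₁ R₂ R₃ ≃ c ⊕ z ⊛ (t ⊛ ψ)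
  from-one {ψ} start = Igf-valued λ where
    zero    → valued-zero
    (suc N) → valued-suc
      ([] ≃-refl ∷ʳ enter-free (λ _ → refl) (λ x ()) (start N) ≈
        solve 1 (λ x → x := con (+ 0) :+ x) ≃-refl (t ⊛ ψ))
      ≃-refl

-- Repeating the maximum b has to be treated apart from repeating a smaller letter. The recurrence
-- then asks for 1 = c G + z t q, and this c makes the value exactly q^b.
≥-≤-≠ : (# 1 ⊝ z) ⊛ (# 1 ⊝ z ⊛ t ⊝ z ^ₛ 2 ⊛ t) ⊛ Igf ≥r ≤r ≠r ≃ # 1 ⊝ z ⊕ z ^ₛ 3 ⊛ t
≥-≤-≠ = ≃-trans
  (from-one λ N → valued-resp (λ { zero → refl ; (suc x) → refl }) (λ _ → mk⇔ id id) (head N 0))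
  (solve 2 (λ z t → (1′ :- z) :* (1′ :- z :* t :- z ^′ 2 :* t) :+ z :* (t :* 1′)
     := 1′ :- z :+ z ^′ 3 :* t) ≃-refl z t)
  where
  c : Series
  c = (# 1 ⊝ z) ⊛ (# 1 ⊝ z ⊛ t ⊝ z ^ₛ 2 ⊛ t)
  open Staircase c ≥r ≤r ≠r ℕₚ.<⇒≱
  open StartAtOne c ≥r ≤r ≠r
  open Decreasing ≤r ℕₚ.≤-trans ℕₚ.<⇒≤ id (# 1) (inj₂ ((λ v → ℕₚ.≤-refl) , ≃-refl))

  q : Series
  q = p true

  -- For w ≠ u the letter u is its own witness. For w = u the third relation demands a different
  -- letter, and the maximum b > u serves.
  active : ∀ {b v} → v < b → Active (stair (suc b)) v
  active {b} {v} v<b = record { sound = λ _ _ u≤w _ → u≤w ; complete = complete′ }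
    where
    complete′ : ∀ {u w} → u ≤ v → u ≤ w →
      ∃ λ x → stair (suc b) x ≡ true × u ≤ x × u ≤ w × x ≢ w
    complete′ {u} {w} u≤v u≤w with u ℕ.≟ w
    ... | no  u≢w  = u , stair-true (ℕₚ.m≤n⇒m≤1+n u<b) , ℕₚ.≤-refl , u≤w , u≢w
      where
      u<b = ℕₚ.≤-<-trans u≤v v<b
    ... | yes refl = b , stair-true (ℕₚ.n<1+n b) , ℕₚ.<⇒≤ u<b , u≤w , ℕₚ.<⇒≢ u<b ∘ sym
      where
      u<b = ℕₚ.≤-<-trans u≤v v<b

  sum-below : ℕ → Series
  sum-below b = Σ< b (λ u → weight (stair (suc b) u) ⊛ value (stair (suc b)) u)

  z-sum-below : ∀ b → c ⊛ (q ^ₛ b ⊝ # 1) ≃ z ⊛ sum-below b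
  z-sum-below b = ≃-trans
    (⊛-congˡ c (⊕-congʳ (⊝ # 1) (≃-sym (prod-true p b (λ x x<b → stair-true (ℕₚ.m≤n⇒m≤1+n x<b))))))
    (≃-sym (telescope (stair (suc b)) b))

  -- The only seen letter x ≥ b is b itself, and the third relation exempts w = b. So only larger
  -- letters become forbidden, and b may recur, which gives the factor `G`, until a smaller letter
  -- starts the decrease.
  top-repeated : ∀ N n b → b < n → Val N n (stair (suc b)) (b <_) (c ⊛ (G ⊛ q ^ₛ b))

  enter-top : ∀ N n b {F} → b ≤ n → ¬ F b → (∀ w → F w → b < w) → (∀ w → b < w → Ext (stair (suc b)) F b w) →
    Ch N n (stair (suc b)) F b (weight (stair (suc b) b) ⊛ (c ⊛ (G ⊛ q ^ₛ b)))
  enter-top N n b b≤n ok F⇒< <⇒F = enter {F′ = b <_} ok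
    (λ x → sym (∪-absorb (stair (suc b)) b (stair-true (ℕₚ.n<1+n b)) x))
    (λ w → mk⇔ (<⇒F w) (λ where
      (before f)           → F⇒< w f
      (now x x∈ x≥b b≤w x≢w) → ℕₚ.≤∧≢⇒< b≤w (λ { refl → x≢w (ℕₚ.≤-antisym (ℕₚ.≤-pred (stair⇒< x∈)) x≥b) })))
    (top-repeated N (suc n) b (s≤s b≤n))

  top-repeated zero    n b b<n = valued-zero
  top-repeated (suc N) n b b<n with ℕₚ.m≤n⇒∃[o]m+o≡n b<n
  ... | o , refl = valued-suc
    (Sums-split b o
      (Sums-tabulate b _ λ u u<b → enter-active N n u (ℕₚ.<⇒≤ (ℕₚ.<-trans u<b b<n))
        (ℕₚ.<⇒≯ u<b) (λ w b<w → ℕₚ.<⇒≤ (ℕₚ.<-trans u<b b<w)) (active u<b))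
      (enter-top N n b (ℕₚ.<⇒≤ b<n) (ℕₚ.<-irrefl refl) (λ _ → id) (λ _ → before))
      (forbid-all (suc b) (suc o) (λ _ → id)))
    (≃-trans (modulo₁ (c ⊛ Q) (≃⇒⊝≃0 G-eq)
      (solve 4 (λ c z g Q → c :* (g :* Q) := c :+ (c :* (Q :- 1′) :+ z :* (1′ :* (c :* (g :* Q))))
        :+ c :* Q :* (g :- (1′ :+ z :* g))) ≃-refl c z G Q))
      (⊕-congˡ c (≃-trans (⊕-cong (z-sum-below b)
          (≃-reflexive (cong (λ e → z ⊛ (weight e ⊛ (c ⊛ (G ⊛ Q)))) (sym (stair-true (ℕₚ.n<1+n b))))))
        (solve 3 (λ z s x → z :* s :+ z :* x := z :* (s :+ x :+ con (+ 0))) ≃-refl z (sum-below b)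
          (weight (stair (suc b) b) ⊛ (c ⊛ (G ⊛ Q)))))))
    where
    Q = q ^ₛ b

  head : ∀ N b → Val N (suc b) (stair (suc b)) (λ _ → ⊥) (q ^ₛ b)
  head zero    b = valued-zero
  head (suc N) b = stair-suc
    ((Sums-tabulate b _ λ u u<b → enter-active N (suc b) u (ℕₚ.m≤n⇒m≤1+n (ℕₚ.<⇒≤ u<b)) id (λ _ ()) (active u<b))
      ∷ʳ enter-top N (suc b) b (ℕₚ.n≤1+n b) id (λ _ ())
           (λ w b<w → now b (stair-true (ℕₚ.n<1+n b)) ℕₚ.≤-refl (ℕₚ.<⇒≤ b<w) (ℕₚ.<⇒≢ b<w))
      ≈ ≃-refl)
    (head N (suc b))
    (≃-trans (modulo₁ (⊝ ((# 1 ⊝ z ⊛ t ⊝ z ^ₛ 2 ⊛ t) ⊛ Q)) (≃-trans (solve 2 (λ z g → (1′ :- z) :* (1′ :+ z :* g) :- 1′ := z :* ((1′ :- z) :* g :- 1′)) ≃-refl z G)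
         (≃-trans (⊛-congˡ z G-inverse) (solve 1 (λ z → z :* con (+ 0) := con (+ 0)) ≃-refl z)))
      (solve 4 (λ z t g Q →
        let c = (1′ :- z) :* (1′ :- z :* t :- z ^′ 2 :* t)
            q = 1′ :+ z :* (1′ :* 1′)
        in Q := c :+ (c :* (Q :- 1′) :+ z :* (1′ :* (c :* (g :* Q))) :+ z :* (t :* (q :* Q)))
             :+ (:- ((1′ :- z :* t :- z ^′ 2 :* t) :* Q)) :* ((1′ :- z) :* (1′ :+ z :* g) :- 1′)) ≃-refl z t G Q))
      (⊕-congˡ c (≃-trans (⊕-congʳ (z ⊛ (t ⊛ (q ⊛ Q))) (⊕-cong (z-sum-below b)
          (≃-reflexive (cong (λ e → z ⊛ (weight e ⊛ (c ⊛ (G ⊛ Q)))) (sym (stair-true (ℕₚ.n<1+n b)))))))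
        (solve 4 (λ z s x y → z :* s :+ z :* x :+ z :* y := z :* (s :+ x :+ y)) ≃-refl z (sum-below b)
          (weight (stair (suc b) b) ⊛ (c ⊛ (G ⊛ Q))) (t ⊛ (q ⊛ Q))))))
    where
    Q = q ^ₛ b

-- Patterns whose words begin with zeros

only-zero : ℕ → Bool
only-zero = ℕ._≡ᵇ 0

only-zero⇒≡ : ∀ {x} → only-zero x ≡ true → x ≡ 0
only-zero⇒≡ {zero} refl = refl

module Zeros (c : Series) (R₁ R₂ R₃ : Rel) (irreflexive : ¬ ⟦ R₁ ⟧ 0 0) where
  open Words c R₁ R₂ R₃ public
  open StartAtOne c R₁ R₂ R₃ public

  zeros-suc : ∀ {N a φ ψ X} → Val N (suc (suc a)) only-zero (λ _ → ⊥) ψ →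
    Sums (λ j → Ch N (suc a) only-zero (λ _ → ⊥) (suc j)) (suc a) X →
    φ ≃ c ⊕ z ⊛ (ψ ⊕ X) → Val (suc N) (suc a) only-zero (λ _ → ⊥) φ
  zeros-suc {ψ = ψ} {X} next above φ≃ = valued-suc
    (Sums-++ 1
      ([] ≃-refl ∷ʳ enter-free (λ x → sym (∪-absorb only-zero 0 refl x))
        (λ x x∈ r → irreflexive (subst (λ y → ⟦ R₁ ⟧ y 0) (only-zero⇒≡ x∈) r)) next
        ≈ solve 1 (λ ψ → ψ := con (+ 0) :+ 1′ :* ψ) ≃-refl ψ)
      above)
    φ≃

-- The 0 before the first nonzero letter forbids every nonzero letter after it, so only zeros
-- follow. With n choices for that letter the value is α + n β, where β = z β + z t c G and α = c +
-- z (α + β).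
<---< : (# 1 ⊝ z) ^ₛ 3 ⊛ Igf <r -r <r
  ≃ # 1 ⊝ # 3 ⊛ z ⊕ z ⊛ t ⊕ # 3 ⊛ z ^ₛ 2 ⊝ # 2 ⊛ z ^ₛ 2 ⊛ t ⊕ z ^ₛ 2 ⊛ t ^ₛ 2 ⊝ z ^ₛ 3 ⊕ z ^ₛ 3 ⊛ t
<---< = ≃-trans (from-one (λ N → head N 0))
  (solve 2 (λ z t → (1′ :- z) ^′ 3 :+ z :* (t :* ((1′ :- z) ^′ 2 :+ z ^′ 2 :* t :+ 1′ :* (z :* t :* (1′ :- z))))
     := 1′ :- 3′ :* z :+ z :* t :+ 3′ :* z ^′ 2 :- 2′ :* z ^′ 2 :* t :+ z ^′ 2 :* t ^′ 2 :- z ^′ 3 :+ z ^′ 3 :* t)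
     ≃-refl z t)
  where
  c α β : Series
  c = (# 1 ⊝ z) ^ₛ 3
  α = (# 1 ⊝ z) ^ₛ 2 ⊕ z ^ₛ 2 ⊛ t
  β = z ⊛ t ⊛ (# 1 ⊝ z)
  open Zeros c <r -r <r (ℕₚ.<-irrefl refl)

  head : ∀ N a → Val N (suc a) only-zero (λ _ → ⊥) (α ⊕ # (suc a) ⊛ β)
  head zero    a = valued-zero
  head (suc N) a = zeros-suc (head N (suc a))
    (Sums-tabulate (suc a) (λ _ → t ⊛ (c ⊛ G)) λ j _ →
      enter {M′ = only-zero ∪ suc j} {F′ = 0 ≢_} id (λ _ → refl)
        (λ w → mk⇔ (λ 0≢w → now 0 refl (s≤s z≤n) tt (ℕₚ.≤∧≢⇒< z≤n 0≢w))
                   (λ { (before ()) ; (now x _ _ _ x<w) → ℕₚ.<⇒≢ (ℕₚ.≤-<-trans z≤n x<w) }))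
        (stay N (suc (suc a)) 0 (s≤s z≤n) refl
          (λ w → λ { (before 0≢w) → 0≢w ; (now _ _ () _ _) })))
    (≃-trans (modulo₁ (⊝ (n ⊛ (z ⊛ (t ⊛ (# 1 ⊝ z) ^ₛ 2)))) G-inverse
      (solve 4 (λ z t g n →
         let c = (1′ :- z) ^′ 3
             α = (1′ :- z) ^′ 2 :+ z ^′ 2 :* t
             β = z :* t :* (1′ :- z)
         in α :+ n :* β := c :+ z :* ((α :+ (1′ :+ n) :* β) :+ n :* (t :* (c :* g)))
            :+ (:- (n :* (z :* (t :* (1′ :- z) ^′ 2)))) :* ((1′ :- z) :* g :- 1′)) ≃-refl z t G n))
      (⊕-congˡ c (⊛-congˡ z (⊕-cong
        (⊕-congˡ α (⊛-congʳ β (≃-sym (#-suc (suc a)))))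
        (≃-sym (Σ<-const (suc a) (t ⊛ (c ⊛ G))))))))
    where
    n = # (suc a)

module ZerosDecreasing (c : Series) (Rt : Rel)
    (down : ∀ {u v w} → u ≤ v → ⟦ Rt ⟧ v w → ⟦ Rt ⟧ u w)
    (<⇒Rt : ∀ {v w} → v < w → ⟦ Rt ⟧ v w)
    (Rt⇒≤ : ∀ {v w} → ⟦ Rt ⟧ v w → v ≤ w)
    (κ : Series)
    (diagonal : (∀ v → ¬ ⟦ Rt ⟧ v v) × κ ≃ # 1 ⊕ z ⊛ κ ⊎ (∀ v → ⟦ Rt ⟧ v v) × κ ≃ # 1)
    (α β : Series)
    -- The two equations compare the constant term and the coefficient of q^(a + 1) in the
    -- recurrence, with 1 + z κ for the letter 0 and q = 1 + z t κ for each unseen letter.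
    (α-eq : α ≃ c ⊕ z ⊛ α ⊝ c ⊛ (# 1 ⊕ z ⊛ (# 1 ⊛ κ)))
    (β-eq : β ≃ z ⊛ (β ⊛ (# 1 ⊕ z ⊛ (t ⊛ κ))) ⊕ c ⊛ (# 1 ⊕ z ⊛ (# 1 ⊛ κ)))
    where
  open Zeros c ≠r Rt -r (λ 0≢0 → 0≢0 refl)
  open Decreasing Rt down <⇒Rt Rt⇒≤ κ diagonal

  q : Series
  q = p false

  -- For a nonzero u the witness is 0. For u = 0 the witness must be nonzero, and only the letter
  -- `suc j` just appended is available.
  active : ∀ j → Active (only-zero ∪ suc j) (suc j)
  active j = record { sound = λ _ _ rt _ → rt ; complete = complete′ }
    where
    complete′ : ∀ {u w} → u ≤ suc j → ⟦ Rt ⟧ u w →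
      ∃ λ x → (only-zero ∪ suc j) x ≡ true × x ≢ u × ⟦ Rt ⟧ u w × ⊤
    complete′ {zero}  _ rt = suc j , ∪-self only-zero (suc j) , (λ ()) , rt , tt
    complete′ {suc u} _ rt = 0 , refl , (λ ()) , rt , tt

  prod-only-zero : ∀ k → prod p only-zero (suc k) ≃ p true ⊛ q ^ₛ k
  prod-only-zero zero    = solve 1 (λ x → 1′ :* x := x :* 1′) ≃-refl (p true)
  prod-only-zero (suc k) = ≃-trans (⊛-congʳ q (prod-only-zero k))
    (solve 3 (λ x q Q → x :* Q :* q := x :* (q :* Q)) ≃-refl (p true) q (q ^ₛ k))

  sum-above : ℕ → Series
  sum-above k = Σ< k (λ j → t ⊛ value only-zero (suc j))

  -- The largest letter ranges over nonzero letters only, so the factor of the letter 0 stays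
  -- outside the telescoping difference.
  z-sum-above : ∀ k → z ⊛ sum-above k ≃ c ⊛ (p true ⊛ (q ^ₛ k ⊝ # 1))
  z-sum-above zero    = solve 3 (λ z c x → z :* con (+ 0) := c :* (x :* (1′ :- 1′))) ≃-refl z c (p true)
  z-sum-above (suc k) = ≃-trans
    (solve 3 (λ z s x → z :* (s :+ x) := z :* s :+ z :* x) ≃-refl z (sum-above k) (t ⊛ value only-zero (suc k)))
    (≃-trans (⊕-cong (z-sum-above k) (⊛-congˡ z (⊛-congˡ t (⊛-congˡ c (⊛-congˡ κ (prod-only-zero k))))))
      (solve 7 (λ c z t κ p q Q → c :* (p :* (Q :- 1′)) :+ z :* (t :* (c :* (κ :* (p :* Q))))
         := c :* (p :* ((1′ :+ z :* (t :* κ)) :* Q :- 1′))) ≃-refl c z t κ (p true) q (q ^ₛ k)))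

  head : ∀ N a → Val N (suc a) only-zero (λ _ → ⊥) (α ⊕ β ⊛ q ^ₛ suc a)
  head zero    a = valued-zero
  head (suc N) a = zeros-suc (head N (suc a))
    (Sums-tabulate (suc a) _ λ j j≤a → enter-decreasing N (suc a) (suc j) j≤a id (λ _ ()) (active j)
      (λ rt → 0 , refl , (λ ()) , rt , tt))
    (≃-trans (≃-trans (⊕-cong α-eq (⊛-congʳ Q β-eq))
      (solve 7 (λ c z α β q p Q → (c :+ z :* α :- c :* p) :+ (z :* (β :* q) :+ c :* p) :* Q
        := c :+ (z :* (α :+ β :* (q :* Q)) :+ c :* (p :* (Q :- 1′)))) ≃-refl c z α β q (p true) Q))
      (⊕-congˡ c (≃-trans
        (⊕-congˡ (z ⊛ (α ⊕ β ⊛ (q ⊛ Q))) (≃-sym (z-sum-above (suc a))))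
        (solve 3 (λ z x y → z :* x :+ z :* y := z :* (x :+ y)) ≃-refl z (α ⊕ β ⊛ (q ⊛ Q)) (sum-above (suc a))))))
    where
    Q = q ^ₛ suc a

  result : c ⊛ Igf ≠r Rt -r ≃ c ⊕ z ⊛ (t ⊛ (α ⊕ β ⊛ (q ⊛ # 1)))
  result = from-one (λ N → head N 0)

≠-< : (# 1 ⊝ z) ^ₛ 2 ⊛ (# 1 ⊝ # 2 ⊛ z ⊕ z ^ₛ 2 ⊝ z ^ₛ 2 ⊛ t) ⊛ Igf ≠r <r -r
  ≃ # 1 ⊝ # 4 ⊛ z ⊕ z ⊛ t ⊕ # 6 ⊛ z ^ₛ 2 ⊝ # 4 ⊛ z ^ₛ 2 ⊛ t ⊕ z ^ₛ 2 ⊛ t ^ₛ 2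
    ⊝ # 4 ⊛ z ^ₛ 3 ⊕ # 5 ⊛ z ^ₛ 3 ⊛ t ⊝ z ^ₛ 3 ⊛ t ^ₛ 2 ⊕ z ^ₛ 4 ⊝ # 2 ⊛ z ^ₛ 4 ⊛ t ⊕ z ^ₛ 4 ⊛ t ^ₛ 2
≠-< = ≃-trans
  (ZerosDecreasing.result ((# 1 ⊝ z) ^ₛ 2 ⊛ D) <r ℕₚ.≤-<-trans id ℕₚ.<⇒≤
    G (inj₁ ((λ v → ℕₚ.<-irrefl refl) , G-eq)) (⊝ (z ⊛ D)) ((# 1 ⊝ z) ^ₛ 2)
    (modulo₁ ((# 1 ⊝ z) ⊛ D ⊛ z) G-inverse
      (solve 3 (λ z t g → let D = D′ z t ; c = (1′ :- z) ^′ 2 :* D in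
        :- (z :* D) := c :+ z :* (:- (z :* D)) :- c :* (1′ :+ z :* (1′ :* g))
          :+ (1′ :- z) :* D :* z :* ((1′ :- z) :* g :- 1′)) ≃-refl z t G))
    (modulo₁ (⊝ (z ^ₛ 2 ⊛ t ⊛ (# 1 ⊝ z) ⊕ (# 1 ⊝ z) ⊛ D ⊛ z)) G-inverse
      (solve 3 (λ z t g → let D = D′ z t ; c = (1′ :- z) ^′ 2 :* D in
        (1′ :- z) ^′ 2 := z :* ((1′ :- z) ^′ 2 :* (1′ :+ z :* (t :* g))) :+ c :* (1′ :+ z :* (1′ :* g))
          :+ (:- (z ^′ 2 :* t :* (1′ :- z) :+ (1′ :- z) :* D :* z)) :* ((1′ :- z) :* g :- 1′)) ≃-refl z t G)))
  (modulo₁ (z ^ₛ 2 ⊛ t ^ₛ 2 ⊛ (# 1 ⊝ z)) G-inverse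
    (solve 3 (λ z t g → let D = D′ z t ; c = (1′ :- z) ^′ 2 :* D in
      c :+ z :* (t :* (:- (z :* D) :+ (1′ :- z) ^′ 2 :* ((1′ :+ z :* (t :* g)) :* 1′)))
      := 1′ :- 4′ :* z :+ z :* t :+ con (+ 6) :* z ^′ 2 :- 4′ :* z ^′ 2 :* t :+ z ^′ 2 :* t ^′ 2
           :- 4′ :* z ^′ 3 :+ con (+ 5) :* z ^′ 3 :* t :- z ^′ 3 :* t ^′ 2
           :+ z ^′ 4 :- 2′ :* z ^′ 4 :* t :+ z ^′ 4 :* t ^′ 2
         :+ z ^′ 2 :* t ^′ 2 :* (1′ :- z) :* ((1′ :- z) :* g :- 1′)) ≃-refl z t G))
  where
  D : Series
  -- This is (1 - z) (1 - z q) with q = 1 + z t G; it clears the denominator of β = c (1 + z G) / (1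
  -- - z q).
  D = # 1 ⊝ # 2 ⊛ z ⊕ z ^ₛ 2 ⊝ z ^ₛ 2 ⊛ t
  D′ : ∀ {n} → Polynomial n → Polynomial n → Polynomial n
  D′ z t = 1′ :- 2′ :* z :+ z ^′ 2 :- z ^′ 2 :* t

≠-≤ : (# 1 ⊝ z) ⊛ (# 1 ⊝ z ⊝ z ^ₛ 2 ⊛ t) ⊛ Igf ≠r ≤r -r
  ≃ # 1 ⊝ # 2 ⊛ z ⊕ z ⊛ t ⊕ z ^ₛ 2 ⊝ # 2 ⊛ z ^ₛ 2 ⊛ t ⊕ z ^ₛ 2 ⊛ t ^ₛ 2 ⊕ z ^ₛ 3 ⊛ t
≠-≤ = ≃-trans
  (ZerosDecreasing.result ((# 1 ⊝ z) ⊛ D) ≤r ℕₚ.≤-trans ℕₚ.<⇒≤ id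
    (# 1) (inj₂ ((λ v → ℕₚ.≤-refl) , ≃-refl)) (⊝ (z ⊛ D)) ((# 1 ⊝ z) ⊛ (# 1 ⊕ z))
    (solve 2 (λ z t → let D = D′ z t ; c = (1′ :- z) :* D in
      :- (z :* D) := c :+ z :* (:- (z :* D)) :- c :* (1′ :+ z :* (1′ :* 1′))) ≃-refl z t)
    (solve 2 (λ z t → let D = D′ z t ; c = (1′ :- z) :* D ; β = (1′ :- z) :* (1′ :+ z) in
      β := z :* (β :* (1′ :+ z :* (t :* 1′))) :+ c :* (1′ :+ z :* (1′ :* 1′))) ≃-refl z t))
  (solve 2 (λ z t → let D = D′ z t ; c = (1′ :- z) :* D ; β = (1′ :- z) :* (1′ :+ z) in
    c :+ z :* (t :* (:- (z :* D) :+ β :* ((1′ :+ z :* (t :* 1′)) :* 1′)))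
    := 1′ :- 2′ :* z :+ z :* t :+ z ^′ 2 :- 2′ :* z ^′ 2 :* t :+ z ^′ 2 :* t ^′ 2 :+ z ^′ 3 :* t) ≃-refl z t)
  where
  D : Series
  D = # 1 ⊝ z ⊝ z ^ₛ 2 ⊛ t
  D′ : ∀ {n} → Polynomial n → Polynomial n → Polynomial n
  D′ z t = 1′ :- z :- z ^′ 2 :* t

-- Patterns whose words begin weakly increasing

Σ<-suc : ∀ n f → Σ< (suc n) f ≃ f 0 ⊕ Σ< n (f ∘ suc)
Σ<-suc zero    f = solve 1 (λ x → con (+ 0) :+ x := x :+ con (+ 0)) ≃-refl (f 0)
Σ<-suc (suc n) f = ≃-trans (⊕-congʳ (f (suc n)) (Σ<-suc n f))
  (solve 3 (λ a b c → a :+ b :+ c := a :+ (b :+ c)) ≃-refl (f 0) (Σ< n (f ∘ suc)) (f (suc n)))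

Σ<-⊕ : ∀ n f g → Σ< n (λ v → f v ⊕ g v) ≃ Σ< n f ⊕ Σ< n g
Σ<-⊕ zero    f g = solve 0 (con (+ 0) := con (+ 0) :+ con (+ 0)) ≃-refl
Σ<-⊕ (suc n) f g = ≃-trans (⊕-congʳ (f n ⊕ g n) (Σ<-⊕ n f g))
  (solve 4 (λ a b c d → a :+ b :+ (c :+ d) := a :+ c :+ (b :+ d)) ≃-refl (Σ< n f) (Σ< n g) (f n) (g n))

record Maximum (M : ℕ → Bool) (m : ℕ) : Set where
  field
    attained : M m ≡ true
    above    : ∀ {x} → m < x → M x ≡ false

  bound : ∀ {x} → M x ≡ true → x ≤ m
  bound x∈ = ℕₚ.≮⇒≥ λ m<x → contradiction (trans (sym x∈) (above m<x)) λ ()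

  raise : ∀ {v} → m < v → Maximum (M ∪ v) v
  raise {v} m<v = record
    { attained = ∪-self M v
    ; above    = λ v<x → trans (∪-other M v (ℕₚ.<⇒≢ v<x ∘ sym)) (above (ℕₚ.<-trans m<v v<x))
    }
open Maximum

maximum-only-zero : Maximum only-zero 0
maximum-only-zero = record { attained = refl ; above = λ { {suc x} _ → refl } }

module Ascending (c : Series) (R₂ : Rel) where
  open Words c >r R₂ -r public
  open StartAtOne c >r R₂ -r public

  -- The gap g counts the letters above the maximum m that a word of the present length may already
  -- contain, so g + 1 larger letters are available next. Repeating m raises the gap by one; the new
  -- maximum m + 1 + j skips j letters and lowers it to g - j.
  ascending-suc : ∀ {N n M m g φ ψ X} (f : ℕ → Series) → n ≡ suc (m ℕ.+ g) → Maximum M m →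
    Sums (Ch N n M (λ _ → ⊥)) m X →
    (suc n ≡ suc (m ℕ.+ suc g) → Val N (suc n) M (λ _ → ⊥) ψ) →
    (∀ j → suc n ≡ suc (suc m ℕ.+ j ℕ.+ (g ∸ j)) →
       Val N (suc n) (M ∪ (suc m ℕ.+ j)) (λ _ → ⊥) (f j)) →
    φ ≃ c ⊕ z ⊛ (X ⊕ ψ ⊕ Σ< (suc g) (λ j → t ⊛ f j)) → Val (suc N) n M (λ _ → ⊥) φ
  ascending-suc {M = M} {m} {g} {ψ = ψ} {X} f refl max below same higher φ≃ = valued-suc
    (Sums-split m g below
      (enter-free (λ x → sym (∪-absorb M m (max .attained) x)) (λ x x∈ → ℕₚ.≤⇒≯ (bound max x∈))
        (same (cong suc (sym (ℕₚ.+-suc m g)))))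
      (Sums-tabulate (suc g) (λ j → weight (M (suc m ℕ.+ j)) ⊛ f j) λ j j≤g →
        enter-free (λ _ → refl) (λ x x∈ → ℕₚ.≤⇒≯ (ℕₚ.≤-trans (bound max x∈) (ℕₚ.<⇒≤ (m<m+1+j j))))
          (higher j (sym (cong suc (trans (ℕₚ.+-assoc (suc m) j (g ∸ j))
            (cong (suc m ℕ.+_) (ℕₚ.m+[n∸m]≡n (ℕₚ.≤-pred j≤g)))))))))
    (≃-trans φ≃ (⊕-congˡ c (⊛-congˡ z (⊕-cong
      (⊕-congˡ X (≃-trans (solve 1 (λ x → x := 1′ :* x) ≃-refl ψ)
        (≃-reflexive (cong (λ b → weight b ⊛ ψ) (sym (max .attained))))))
      (Σ<-cong (suc g) λ j _ → ≃-reflexive (cong (λ b → weight b ⊛ f j) (sym (max .above (m<m+1+j j)))))))))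
    where
    m<m+1+j : ∀ j → m < suc m ℕ.+ j
    m<m+1+j j = s≤s (ℕₚ.m≤m+n m j)

module AscendingDecreasing (c : Series) (Rt : Rel)
    (down : ∀ {u v w} → u ≤ v → ⟦ Rt ⟧ v w → ⟦ Rt ⟧ u w)
    (<⇒Rt : ∀ {v w} → v < w → ⟦ Rt ⟧ v w)
    (Rt⇒≤ : ∀ {v w} → ⟦ Rt ⟧ v w → v ≤ w)
    (κ : Series)
    (diagonal : (∀ v → ¬ ⟦ Rt ⟧ v v) × κ ≃ # 1 ⊕ z ⊛ κ ⊎ (∀ v → ⟦ Rt ⟧ v v) × κ ≃ # 1)
    where
  open Ascending c Rt
  open Decreasing Rt down <⇒Rt Rt⇒≤ κ diagonal

  active : ∀ {M m u} → Maximum M m → u < m → Active M u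
  active {m = m} max u<m = record
    { sound    = λ _ _ rt _ → rt
    ; complete = λ u′≤u rt → m , max .attained , ℕₚ.≤-<-trans u′≤u u<m , rt , tt
    }

  -- `q` belongs to a skipped letter. `X` is the z t of a new maximum times the factor of the old
  -- maximum, now a smaller seen letter.
  q X : Series
  q = p false
  X = z ⊛ (t ⊛ p true)

  prod-above : ∀ {M m} → Maximum M m → ∀ j →
    prod p (M ∪ (suc m ℕ.+ j)) (suc m ℕ.+ j) ≃ prod p M m ⊛ (p true ⊛ q ^ₛ j)
  prod-above {M} {m} max j = ≃-trans (≃-reflexive (prod-∪ p M (suc m ℕ.+ j))) (go j)
    where
    P : Series
    P = prod p M m
    go : ∀ j → prod p M (suc m ℕ.+ j) ≃ P ⊛ (p true ⊛ q ^ₛ j)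
    go zero rewrite ℕₚ.+-identityʳ m = ≃-trans (≃-reflexive (cong (λ b → P ⊛ p b) (max .attained)))
      (solve 2 (λ a b → a :* b := a :* (b :* 1′)) ≃-refl P (p true))
    go (suc j) rewrite ℕₚ.+-suc m j = ≃-trans
      (⊛-congʳ (p (M (suc m ℕ.+ j))) (go j))
      (≃-trans (≃-reflexive (cong (λ b → P ⊛ (p true ⊛ q ^ₛ j) ⊛ p b) (max .above (s≤s (ℕₚ.m≤m+n m j)))))
        (solve 4 (λ P a q Q → P :* (a :* Q) :* q := P :* (a :* (q :* Q))) ≃-refl P (p true) q (q ^ₛ j)))

  module _ (ρ β : Series)
      -- ρ is a root of the kernel, and 1 solves the inhomogeneous recurrence for the values a below.
      (eq₀ : X ⊛ (# 1 ⊕ β ⊛ ρ) ≃ # 1 ⊕ β ⊛ ρ ⊝ c ⊝ z ⊛ (# 1 ⊕ β ⊛ (ρ ⊛ ρ)))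
      (eq₁ : X ⊕ q ⊛ (# 1 ⊝ c ⊝ z) ≃ # 1 ⊝ c ⊝ z)
      (eq₂ : X ⊛ ρ ⊕ q ⊝ q ⊛ (z ⊛ ρ) ≃ ρ ⊝ z ⊛ (ρ ⊛ ρ))
      where

    a : ℕ → Series
    a g = # 1 ⊕ β ⊛ ρ ^ₛ suc g

    conv : ℕ → Series
    conv g = Σ< (suc g) (λ j → q ^ₛ j ⊛ a (g ∸ j))

    conv-suc : ∀ g → conv (suc g) ≃ a (suc g) ⊕ q ⊛ conv g
    conv-suc g = ≃-trans (Σ<-suc (suc g) (λ j → q ^ₛ j ⊛ a (suc g ∸ j))) (⊕-cong
      (solve 1 (λ x → 1′ :* x := x) ≃-refl (a (suc g)))
      (≃-trans
        (Σ<-cong (suc g) λ j _ → solve 3 (λ q Q x → q :* Q :* x := q :* (Q :* x)) ≃-refl q (q ^ₛ j) (a (g ∸ j)))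
        (≃-sym (Σ<-⊛ q (suc g) (λ j → q ^ₛ j ⊛ a (g ∸ j))))))

    -- This is the recurrence in the gap. By `conv-suc`, subtracting q times the preceding instance
    -- removes the convolution; what remains splits into `eq₁` for the constant and `eq₂` for the
    -- powers of ρ, while `eq₀` is the case g = 0.
    X-conv : ∀ g → X ⊛ conv g ≃ a g ⊝ c ⊝ z ⊛ a (suc g)
    X-conv zero    = ≃-trans
      (solve 3 (λ X b l → X :* (con (+ 0) :+ 1′ :* (1′ :+ b :* (l :* 1′))) := X :* (1′ :+ b :* l)) ≃-refl X β ρ)
      (≃-trans eq₀ (solve 4 (λ c z b l → 1′ :+ b :* l :- c :- z :* (1′ :+ b :* (l :* l))
        := 1′ :+ b :* (l :* 1′) :- c :- z :* (1′ :+ b :* (l :* (l :* 1′)))) ≃-refl c z β ρ))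
    X-conv (suc g) = ≃-trans (⊛-congˡ X (conv-suc g)) (≃-trans
      (solve 4 (λ X y q w → X :* (y :+ q :* w) := X :* y :+ q :* (X :* w)) ≃-refl X (a (suc g)) q (conv g))
      (≃-trans (⊕-congˡ (X ⊛ a (suc g)) (⊛-congˡ q (X-conv g)))
      (modulo₂ (# 1) (β ⊛ L) (≃⇒⊝≃0 eq₁) (≃⇒⊝≃0 eq₂)
        (solve 7 (λ X q c z b l L →
          X :* (1′ :+ b :* (l :* L)) :+ q :* (1′ :+ b :* L :- c :- z :* (1′ :+ b :* (l :* L)))
          := 1′ :+ b :* (l :* L) :- c :- z :* (1′ :+ b :* (l :* (l :* L)))
             :+ 1′ :* (X :+ q :* (1′ :- c :- z) :- (1′ :- c :- z))
             :+ b :* L :* (X :* l :+ q :- q :* (z :* l) :- (l :- z :* (l :* l)))) ≃-refl X q c z β ρ L))))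
      where
      L : Series
      L = ρ ^ₛ suc g

    -- Let P be the product over the letters below the maximum. The descents contribute c (P - 1),
    -- which with the c of the word makes c P, and each ascent keeps the factor P. Dividing by P
    -- leaves a recurrence in g alone, namely `X-conv`.
    head : ∀ N n {M m} g → n ≡ suc (m ℕ.+ g) → Maximum M m → Val N n M (λ _ → ⊥) (prod p M m ⊛ a g)
    head zero    n g n≡ max = valued-zero
    head (suc N) n {M} {m} g n≡ max = ascending-suc
      (λ j → P ⊛ (p true ⊛ q ^ₛ j) ⊛ a (g ∸ j)) n≡ max
      (Sums-tabulate m (λ u → weight (M u) ⊛ value M u) λ u u<m → enter-active N n u
        (ℕₚ.≤-trans (ℕₚ.<⇒≤ u<m) (subst (m ≤_) (sym n≡) (ℕₚ.m≤n⇒m≤1+n (ℕₚ.m≤m+n m g))))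
        id (λ _ ()) (active max u<m))
      (λ n≡′ → head N (suc n) (suc g) n≡′ max)
      (λ j n≡′ → valued-≃ (⊛-congʳ (a (g ∸ j)) (prod-above max j))
        (head N (suc n) (g ∸ j) n≡′ (raise max (s≤s (ℕₚ.m≤m+n m j)))))
      (≃-trans (modulo₂ (⊝ # 1) (⊝ P) (≃⇒⊝≃0 (telescope M m)) (≃⇒⊝≃0 (X-conv g))
        (solve 9 (λ P x c z y s t r w → P :* x
          := c :+ z :* (s :+ P :* y :+ t :* (P :* (r :* w))) :+ (:- 1′) :* (z :* s :- c :* (P :- 1′))
            :+ (:- P) :* (z :* (t :* r) :* w :- (x :- c :- z :* y)))
          ≃-refl P (a g) c z (a (suc g)) sum-below t (p true) (conv g)))
        (⊕-congˡ c (⊛-congˡ z (⊕-congˡ (sum-below ⊕ P ⊛ a (suc g)) Σ-above))))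
      where
      P sum-below : Series
      P = prod p M m
      sum-below = Σ< m (λ u → weight (M u) ⊛ value M u)
      Σ-above : t ⊛ (P ⊛ (p true ⊛ conv g)) ≃ Σ< (suc g) (λ j → t ⊛ (P ⊛ (p true ⊛ q ^ₛ j) ⊛ a (g ∸ j)))
      Σ-above = ≃-trans
        (solve 4 (λ t P r w → t :* (P :* (r :* w)) := t :* P :* r :* w) ≃-refl t P (p true) (conv g))
        (≃-trans (Σ<-⊛ (t ⊛ P ⊛ p true) (suc g) (λ j → q ^ₛ j ⊛ a (g ∸ j)))
        (Σ<-cong (suc g) λ j _ → solve 5 (λ t P r Q x → t :* P :* r :* (Q :* x) := t :* (P :* (r :* Q) :* x))
          ≃-refl t P (p true) (q ^ₛ j) (a (g ∸ j))))

    result : c ⊛ Igf >r Rt -r ≃ c ⊕ z ⊛ (t ⊛ (# 1 ⊛ (# 1 ⊕ β ⊛ (ρ ⊛ # 1))))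
    result = from-one (λ N → head N 1 0 refl maximum-only-zero)

-- 2 z λ = 1 + z - z t - S for the power series root λ of the kernel and the square root S of its discriminant.
module KernelRoot (q : Series) where

  abstract
    root : Series
    root = Quadratic.solution q (t ⊝ # 1) (# 1)

    root-eq : q ⊕ (z ⊛ t ⊝ z ⊝ # 1) ⊛ root ⊕ z ⊛ (root ⊛ root) ≃ # 0
    root-eq = ≃-trans
      (solve 4 (λ z t q l → q :+ (z :* t :- z :- 1′) :* l :+ z :* (l :* l)
         := q :+ z :* ((t :- 1′) :* l :+ 1′ :* (l :* l)) :- l) ≃-refl z t q root)
      (≃⇒⊝≃0 (≃-sym (Quadratic.solution-eq q (t ⊝ # 1) (# 1))))

  H : Series
  H = geometric root

  H-eq : # 1 ⊝ H ⊕ z ⊛ (root ⊛ H) ≃ # 0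
  H-eq = ≃-trans (solve 3 (λ z l h → 1′ :- h :+ z :* (l :* h) := 1′ :+ z :* (l :* h) :- h) ≃-refl z root H)
    (≃⇒⊝≃0 (≃-sym (geometric-eq root)))

  discriminant : Series
  discriminant = # 1 ⊕ z ⊝ z ⊛ t ⊝ # 2 ⊛ z ⊛ root

  -- Completing the square: the two sides differ by 4 z times the kernel at its root.
  discriminant² : discriminant ⊛ discriminant ≃ (# 1 ⊕ z ⊝ z ⊛ t) ^ₛ 2 ⊝ # 4 ⊛ z ⊛ q
  discriminant² = modulo₁ (# 4 ⊛ z) root-eq
    (solve 4 (λ z t q l → let S = 1′ :+ z :- z :* t :- 2′ :* z :* l in
      S :* S := (1′ :+ z :- z :* t) ^′ 2 :- 4′ :* z :* q
        :+ 4′ :* z :* (q :+ (z :* t :- z :- 1′) :* l :+ z :* (l :* l))) ≃-refl z t q root)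

>-< : ∃ λ G → ∃ λ S →
  ((# 1 ⊝ z) ⊛ G ≋ # 1)
  × (S 0 0 ≡ + 1)
  × (S ⊛ S ≋ (# 1 ⊕ z ⊝ z ⊛ t) ^ₛ 2 ⊝ # 4 ⊛ z ⊛ (# 1 ⊝ z ⊕ z ⊛ t) ⊛ G)
  × (# 2 ⊛ z ⊛ (# 2 ⊝ z) ⊛ Igf >r <r -r
       ≋ # 1 ⊕ z ⊛ (# 2 ⊝ t) ⊝ z ^ₛ 2 ⊛ (# 1 ⊝ t) ⊝ (# 1 ⊝ z) ⊛ S)
>-< = G , discriminant
  , at (≃-trans (solve 2 (λ z g → (1′ :- z) :* g := (1′ :- z) :* g :- 1′ :+ 1′) ≃-refl z G)
      (≃-trans (⊕-congʳ (# 1) G-inverse) (solve 0 (con (+ 0) :+ 1′ := 1′) ≃-refl)))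
  , refl
  , at (≃-trans discriminant² (modulo₁ (# 4 ⊛ z) G-inverse
      (solve 3 (λ z t g → (1′ :+ z :- z :* t) ^′ 2 :- 4′ :* z :* (1′ :+ z :* (t :* g))
        := (1′ :+ z :- z :* t) ^′ 2 :- 4′ :* z :* (1′ :- z :+ z :* t) :* g
           :+ 4′ :* z :* ((1′ :- z) :* g :- 1′)) ≃-refl z t G)))
  , at (≃-trans
      (solve 2 (λ z i → 2′ :* z :* (2′ :- z) :* i := 2′ :* z :* ((2′ :- z) :* i)) ≃-refl z (Igf >r <r -r))
      (≃-trans (⊛-congˡ (# 2 ⊛ z) counted)
      (modulo₃ (# 2 ⊛ z ⊛ (H ⊛ (# 1 ⊝ z))) (# 2 ⊛ z ⊛ (V ⊝ H ⊛ (z ⊛ (t ⊛ root)))) (⊝ (# 2 ⊛ z ⊛ (H ⊛ (z ⊛ t))))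
        root-eq H-eq G-inverse
        (solve 5 (λ z t g l h →
          let S = 1′ :+ z :- z :* t :- 2′ :* z :* l
              V = 1′ :- z :+ z :* t :+ z :* (t :* (l :* h)) :- (1′ :- z) :* l
          in 2′ :* z :* (2′ :- z :+ z :* (t :* (1′ :* (1′ :+ h :* (l :* 1′)))))
            := 1′ :+ z :* (2′ :- t) :- z ^′ 2 :* (1′ :- t) :- (1′ :- z) :* S
               :+ 2′ :* z :* (h :* (1′ :- z)) :* (1′ :+ z :* (t :* g) :+ (z :* t :- z :- 1′) :* l :+ z :* (l :* l))
               :+ 2′ :* z :* (V :- h :* (z :* (t :* l))) :* (1′ :- h :+ z :* (l :* h))
               :+ (:- (2′ :* z :* (h :* (z :* t)))) :* ((1′ :- z) :* g :- 1′)) ≃-refl z t G root H))))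
  where
  open KernelRoot (# 1 ⊕ z ⊛ (t ⊛ G))
  V : Series
  V = # 1 ⊝ z ⊕ z ⊛ t ⊕ z ⊛ (t ⊛ (root ⊛ H)) ⊝ (# 1 ⊝ z) ⊛ root
  -- With κ = G, `eq₁` amounts to c = 1 + 1/κ = 2 - z. Extended to g = -1 with an empty convolution,
  -- the recurrence reads β (1 - z λ) = c + z - 1 = 1, whence β = `H`.
  counted : (# 2 ⊝ z) ⊛ Igf >r <r -r ≃ # 2 ⊝ z ⊕ z ⊛ (t ⊛ (# 1 ⊛ (# 1 ⊕ H ⊛ (root ⊛ # 1))))
  counted = AscendingDecreasing.result (# 2 ⊝ z) <r ℕₚ.≤-<-trans id ℕₚ.<⇒≤ G
    (inj₁ ((λ v → ℕₚ.<-irrefl refl) , G-eq)) root H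
    (modulo₃ H (# 1 ⊕ z ⊛ (t ⊛ G)) (⊝ (z ⊛ t)) root-eq H-eq G-inverse
      (solve 5 (λ z t g l h → let X = z :* (t :* (1′ :+ z :* (1′ :* g))) in
        X :* (1′ :+ h :* l) := 1′ :+ h :* l :- (2′ :- z) :- z :* (1′ :+ h :* (l :* l))
          :+ h :* (1′ :+ z :* (t :* g) :+ (z :* t :- z :- 1′) :* l :+ z :* (l :* l))
          :+ (1′ :+ z :* (t :* g)) :* (1′ :- h :+ z :* (l :* h))
          :+ (:- (z :* t)) :* ((1′ :- z) :* g :- 1′)) ≃-refl z t G root H))
    (modulo₁ (⊝ (z ⊛ t)) G-inverse
      (solve 3 (λ z t g → z :* (t :* (1′ :+ z :* (1′ :* g))) :+ (1′ :+ z :* (t :* g)) :* (1′ :- (2′ :- z) :- z)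
        := 1′ :- (2′ :- z) :- z :+ (:- (z :* t)) :* ((1′ :- z) :* g :- 1′)) ≃-refl z t G))
    -- In X - z q = z t - z the series κ cancels, so this is the kernel equation itself.
    (modulo₁ (# 1) root-eq
      (solve 4 (λ z t g l → z :* (t :* (1′ :+ z :* (1′ :* g))) :* l :+ (1′ :+ z :* (t :* g)) :- (1′ :+ z :* (t :* g)) :* (z :* l)
        := l :- z :* (l :* l)
           :+ 1′ :* (1′ :+ z :* (t :* g) :+ (z :* t :- z :- 1′) :* l :+ z :* (l :* l))) ≃-refl z t G root))

>-≤ : ∃ λ S →
  (S 0 0 ≡ + 1)
  × (S ⊛ S ≋ # 1 ⊝ z ⊛ (# 2 ⊕ # 2 ⊛ t ⊝ z ⊕ # 6 ⊛ z ⊛ t ⊝ z ⊛ t ^ₛ 2))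
  × (# 4 ⊛ z ⊛ Igf >r ≤r -r ≋ # 1 ⊕ z ⊛ (# 3 ⊝ t) ⊝ S)
>-≤ = discriminant
  , refl
  , at (≃-trans discriminant²
      (solve 2 (λ z t → (1′ :+ z :- z :* t) ^′ 2 :- 4′ :* z :* (1′ :+ z :* (t :* 1′))
        := 1′ :- z :* (2′ :+ 2′ :* t :- z :+ con (+ 6) :* z :* t :- z :* t ^′ 2)) ≃-refl z t))
  , at (≃-trans
      (solve 2 (λ z i → 4′ :* z :* i := 2′ :* z :* (2′ :* i)) ≃-refl z (Igf >r ≤r -r))
      (≃-trans (⊛-congˡ (# 2 ⊛ z) counted)
      (modulo₂ (# 2 ⊛ z ⊛ H) (# 2 ⊛ z ⊛ (W ⊝ H ⊛ (z ⊛ (t ⊛ ((# 1 ⊕ z) ⊛ root))))) root-eq H-eq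
        (solve 4 (λ z t l h →
          let S = 1′ :+ z :- z :* t :- 2′ :* z :* l
              W = 1′ :+ z :* t :+ z :* (t :* ((1′ :+ z) :* (l :* h))) :- l
          in 2′ :* z :* (2′ :+ z :* (t :* (1′ :* (1′ :+ (1′ :+ z) :* h :* (l :* 1′)))))
            := 1′ :+ z :* (3′ :- t) :- S
               :+ 2′ :* z :* h :* (1′ :+ z :* (t :* 1′) :+ (z :* t :- z :- 1′) :* l :+ z :* (l :* l))
               :+ 2′ :* z :* (W :- h :* (z :* (t :* ((1′ :+ z) :* l)))) :* (1′ :- h :+ z :* (l :* h)))
          ≃-refl z t root H))))
  where
  open KernelRoot (# 1 ⊕ z ⊛ (t ⊛ # 1))
  W : Series
  W = # 1 ⊕ z ⊛ t ⊕ z ⊛ (t ⊛ ((# 1 ⊕ z) ⊛ (root ⊛ H))) ⊝ root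
  -- Now κ = 1, so c = 1 + 1/κ = 2, and the boundary equation β (1 - z λ) = c + z - 1 gives β = (1 +
  -- z) `H`.
  counted : # 2 ⊛ Igf >r ≤r -r ≃ # 2 ⊕ z ⊛ (t ⊛ (# 1 ⊛ (# 1 ⊕ (# 1 ⊕ z) ⊛ H ⊛ (root ⊛ # 1))))
  counted = AscendingDecreasing.result (# 2) ≤r ℕₚ.≤-trans ℕₚ.<⇒≤ id (# 1)
    (inj₂ ((λ v → ℕₚ.≤-refl) , ≃-refl)) root ((# 1 ⊕ z) ⊛ H)
    (modulo₂ ((# 1 ⊕ z) ⊛ H) ((# 1 ⊕ z) ⊛ (# 1 ⊕ z ⊛ t)) root-eq H-eq
      (solve 4 (λ z t l h → let X = z :* (t :* (1′ :+ z :* (1′ :* 1′))) ; b = (1′ :+ z) :* h in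
        X :* (1′ :+ b :* l) := 1′ :+ b :* l :- 2′ :- z :* (1′ :+ b :* (l :* l))
          :+ b :* (1′ :+ z :* (t :* 1′) :+ (z :* t :- z :- 1′) :* l :+ z :* (l :* l))
          :+ (1′ :+ z) :* (1′ :+ z :* t) :* (1′ :- h :+ z :* (l :* h))) ≃-refl z t root H))
    (solve 2 (λ z t → z :* (t :* (1′ :+ z :* (1′ :* 1′))) :+ (1′ :+ z :* (t :* 1′)) :* (1′ :- 2′ :- z)
      := 1′ :- 2′ :- z) ≃-refl z t)
    (modulo₁ (# 1) root-eq
      (solve 3 (λ z t l → z :* (t :* (1′ :+ z :* (1′ :* 1′))) :* l :+ (1′ :+ z :* (t :* 1′)) :- (1′ :+ z :* (t :* 1′)) :* (z :* l)
        := l :- z :* (l :* l)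
           :+ 1′ :* (1′ :+ z :* (t :* 1′) :+ (z :* t :- z :- 1′) :* l :+ z :* (l :* l))) ≃-refl z t root))

⊝-congˡ : ∀ f {g h} → g ≃ h → f ⊝ g ≃ f ⊝ h
⊝-congˡ f g≃h = ⊕-congˡ f (CommutativeRing.-‿cong seriesRing g≃h)

module AscendingConstant where
  open KernelRoot (# 1)

  -- The discriminant root is minus the derivative of the kernel at `root`. Solving for the
  -- coefficient of g times a power of `root` divides by it, so it becomes the common denominator.
  c : Series
  c = discriminant

  open Ascending c ≠r

  -- The weight 1 + z G w of the constant phase, with w the weighted number of smaller letters, is the linear
  -- part in ε of a product with factors 1 + ε z G weight; hence b contains a derivative of a power of root.
  b h : ℕ → Series
  b g = c ⊛ G ⊕ z ⊛ t ⊛ G ⊛ H ⊛ (H ⊕ # g) ⊛ root ^ₛ g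
  h g = z ⊛ G ⊛ c ⊛ H ⊛ root ^ₛ suc g

  -- For a value b + W h, with W the weighted number of letters below the maximum, `U` collects the
  -- coefficient of W over all new maxima and `Y` the rest. A new maximum that skips j letters
  -- raises W by 1 + j t.
  U Y : ℕ → Series
  U g = Σ< (suc g) (λ j → h (g ∸ j))
  Y g = Σ< (suc g) (λ j → b (g ∸ j) ⊕ (# 1 ⊕ # j ⊛ t) ⊛ h (g ∸ j))

  c′ : ∀ {n} (z t l : Polynomial n) → Polynomial n
  c′ z t l = 1′ :+ z :- z :* t :- 2′ :* z :* l

  root′ : ∀ {n} (z t l : Polynomial n) → Polynomial n
  root′ z t l = 1′ :+ (z :* t :- z :- 1′) :* l :+ z :* (l :* l)

  H′ : ∀ {n} (z l h : Polynomial n) → Polynomial n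
  H′ z l h = 1′ :- h :+ z :* (l :* h)

  b′ : ∀ {n} (z t g l h k L : Polynomial n) → Polynomial n
  b′ z t g l h k L = c′ z t l :* g :+ z :* t :* g :* h :* (h :+ k) :* L

  h′ : ∀ {n} (z t g l h L : Polynomial n) → Polynomial n
  h′ z t g l h L = z :* g :* c′ z t l :* h :* L

  zt-U : ∀ g → z ⊛ t ⊛ U g ≃ h g ⊝ z ⊛ c ⊛ G ⊝ z ⊛ h (suc g)
  zt-U zero = modulo₂ (z ⊛ G ⊛ c ⊛ H) (z ⊛ G ⊛ c) root-eq H-eq
    (solve 5 (λ z t g l h → z :* t :* (con (+ 0) :+ h′ z t g l h (l :* 1′))
      := h′ z t g l h (l :* 1′) :- z :* c′ z t l :* g :- z :* h′ z t g l h (l :* (l :* 1′))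
         :+ z :* g :* c′ z t l :* h :* root′ z t l :+ z :* g :* c′ z t l :* H′ z l h) ≃-refl z t G root H)
  zt-U (suc g) = ≃-trans (⊛-congˡ (z ⊛ t) (Σ<-suc (suc g) (λ j → h (suc g ∸ j)))) (≃-trans
    (solve 4 (λ z t x y → z :* t :* (x :+ y) := z :* t :* x :+ z :* t :* y) ≃-refl z t (h (suc g)) (U g)) (≃-trans
    (⊕-congˡ (z ⊛ t ⊛ h (suc g)) (zt-U g))
    (modulo₁ (z ⊛ G ⊛ c ⊛ H ⊛ L) root-eq
      (solve 6 (λ z t g l h L →
        z :* t :* h′ z t g l h (l :* L) :+ (h′ z t g l h L :- z :* c′ z t l :* g :- z :* h′ z t g l h (l :* L))
        := h′ z t g l h (l :* L) :- z :* c′ z t l :* g :- z :* h′ z t g l h (l :* (l :* L))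
           :+ z :* g :* c′ z t l :* h :* L :* root′ z t l) ≃-refl z t G root H L))))
    where
    L : Series
    L = root ^ₛ suc g

  Y-suc : ∀ g → Y (suc g) ≃ b (suc g) ⊕ h (suc g) ⊕ (Y g ⊕ t ⊛ U g)
  Y-suc g = ≃-trans (Σ<-suc (suc g) (λ j → b (suc g ∸ j) ⊕ (# 1 ⊕ # j ⊛ t) ⊛ h (suc g ∸ j))) (⊕-cong
    (solve 3 (λ x y t → x :+ (1′ :+ con (+ 0) :* t) :* y := x :+ y) ≃-refl (b (suc g)) (h (suc g)) t)
    (≃-trans (Σ<-cong (suc g) (λ j _ → ≃-trans
        (⊕-congˡ (b (g ∸ j)) (⊛-congʳ (h (g ∸ j)) (⊕-congˡ (# 1) (⊛-congʳ t (#-suc j)))))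
        (solve 4 (λ x j t y → x :+ (1′ :+ (1′ :+ j) :* t) :* y := x :+ (1′ :+ j :* t) :* y :+ t :* y)
          ≃-refl (b (g ∸ j)) (# j) t (h (g ∸ j)))))
    (≃-trans (Σ<-⊕ (suc g) (λ j → b (g ∸ j) ⊕ (# 1 ⊕ # j ⊛ t) ⊛ h (g ∸ j)) (λ j → t ⊛ h (g ∸ j)))
      (⊕-congˡ (Y g) (≃-sym (Σ<-⊛ t (suc g) (λ j → h (g ∸ j))))))))

  b-suc : ∀ g → b (suc g) ≃ c ⊛ G ⊕ z ⊛ t ⊛ G ⊛ H ⊛ (H ⊕ (# 1 ⊕ # g)) ⊛ root ^ₛ suc g
  b-suc g = ⊕-congˡ (c ⊛ G) (⊛-congʳ (root ^ₛ suc g) (⊛-congˡ (z ⊛ t ⊛ G ⊛ H) (⊕-congˡ H (#-suc g))))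

  -- The terms with `h` contain powers of `root`, which already solve the homogeneous recurrence;
  -- this resonance forces the factor g in `b`. Raising the gap by one makes every old summand skip
  -- one more letter, which is how `zt-U` enters.
  zt-Y : ∀ g → z ⊛ t ⊛ Y g ≃ b g ⊝ c ⊝ z ⊛ b (suc g)
  zt-Y zero = modulo₃ (z ⊛ t ⊛ G ⊛ z ⊛ H ⊛ H) (z ⊛ t ⊛ G ⊛ (c ⊕ H ⊕ z ⊛ H ⊛ (# 1 ⊝ t ⊝ root))) (⊝ c)
    root-eq H-eq G-inverse
    (solve 5 (λ z t g l h →
      z :* t :* (con (+ 0) :+ (b′ z t g l h (con (+ 0)) 1′ :+ (1′ :+ con (+ 0) :* t) :* h′ z t g l h (l :* 1′)))
      := b′ z t g l h (con (+ 0)) 1′ :- c′ z t l :- z :* b′ z t g l h 1′ (l :* 1′)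
         :+ z :* t :* g :* z :* h :* h :* root′ z t l
         :+ z :* t :* g :* (c′ z t l :+ h :+ z :* h :* (1′ :- t :- l)) :* H′ z l h
         :+ (:- c′ z t l) :* ((1′ :- z) :* g :- 1′)) ≃-refl z t G root H)
  zt-Y (suc g) = ≃-trans (⊛-congˡ (z ⊛ t) (Y-suc g)) (≃-trans
    (solve 6 (λ z t x y w u → z :* t :* (x :+ y :+ (w :+ t :* u))
       := z :* t :* x :+ z :* t :* y :+ (z :* t :* w :+ t :* (z :* t :* u))) ≃-refl z t (b (suc g)) (h (suc g)) (Y g) (U g))
    (≃-trans (⊕-cong (⊕-congʳ (z ⊛ t ⊛ h (suc g)) (⊛-congˡ (z ⊛ t) (b-suc g)))
      (⊕-cong (≃-trans (zt-Y g) (⊝-congˡ (b g ⊝ c) (⊛-congˡ z (b-suc g)))) (⊛-congˡ t (zt-U g))))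
    (≃-trans (modulo₁ (z ⊛ t ⊛ G ⊛ H ⊛ L ⊛ (H ⊕ # g)) root-eq
      (solve 7 (λ z t g l h k L →
        let b₀ = b′ z t g l h k L
            b₁ = b′ z t g l h (1′ :+ k) (l :* L)
            b₂ = b′ z t g l h (1′ :+ (1′ :+ k)) (l :* (l :* L))
            h₀ = h′ z t g l h (l :* L)
            h₁ = h′ z t g l h (l :* (l :* L))
        in z :* t :* b₁ :+ z :* t :* h₁ :+ (b₀ :- c′ z t l :- z :* b₁ :+ t :* (h₀ :- z :* c′ z t l :* g :- z :* h₁))
           := b₁ :- c′ z t l :- z :* b₂ :+ z :* t :* g :* h :* L :* (h :+ k) :* root′ z t l)
        ≃-refl z t G root H (# g) L))
      (≃-trans (⊕-congʳ (⊝ (z ⊛ b₂)) (⊕-congʳ (⊝ c) (≃-sym (b-suc g))))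
        (⊝-congˡ (b (suc g) ⊝ c) (⊛-congˡ z (≃-sym b-suc²)))))))
    where
    L b₂ : Series
    L = root ^ₛ g
    b₂ = c ⊛ G ⊕ z ⊛ t ⊛ G ⊛ H ⊛ (H ⊕ (# 1 ⊕ (# 1 ⊕ # g))) ⊛ root ^ₛ suc (suc g)
    b-suc² : b (suc (suc g)) ≃ b₂
    b-suc² = ≃-trans (b-suc (suc g)) (⊕-congˡ (c ⊛ G) (⊛-congʳ (root ^ₛ suc (suc g))
      (⊛-congˡ (z ⊛ t ⊛ G ⊛ H) (⊕-congˡ H (⊕-congˡ (# 1) (#-suc g))))))

  -- Every letter below m counts: with 1 if it has been seen, with t if it would be new.
  seen : (ℕ → Bool) → ℕ → Series
  seen M m = Σ< m (λ u → weight (M u))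

  seen-above : ∀ {M m} → Maximum M m → ∀ j →
    seen (M ∪ (suc m ℕ.+ j)) (suc m ℕ.+ j) ≃ seen M m ⊕ (# 1 ⊕ # j ⊛ t)
  seen-above {M} {m} max j = ≃-trans
    (Σ<-cong (suc m ℕ.+ j) λ u u< → ≃-reflexive (cong weight (∪-other M (suc m ℕ.+ j) (ℕₚ.<⇒≢ u<)))) (go j)
    where
    go : ∀ j → seen M (suc m ℕ.+ j) ≃ seen M m ⊕ (# 1 ⊕ # j ⊛ t)
    go zero rewrite ℕₚ.+-identityʳ m = ≃-trans (≃-reflexive (cong (λ e → seen M m ⊕ weight e) (max .attained)))
      (solve 2 (λ s t → s :+ 1′ := s :+ (1′ :+ con (+ 0) :* t)) ≃-refl (seen M m) t)
    go (suc j) rewrite ℕₚ.+-suc m j = ≃-trans (⊕-congʳ (weight (M (suc m ℕ.+ j))) (go j)) (≃-trans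
      (≃-reflexive (cong (λ e → seen M m ⊕ (# 1 ⊕ # j ⊛ t) ⊕ weight e) (max .above (s≤s (ℕₚ.m≤m+n m j)))))
      (≃-trans (solve 3 (λ s j t → s :+ (1′ :+ j :* t) :+ t := s :+ (1′ :+ (1′ :+ j) :* t)) ≃-refl (seen M m) (# j) t)
        (⊕-congˡ (seen M m) (⊕-congˡ (# 1) (⊛-congʳ t (≃-sym (#-suc j)))))))

  -- A descent to u < m forbids every letter but u, with m as witness. All descents together thus
  -- contribute W c G, and the value stays affine in W.
  head : ∀ N n {M m} g → n ≡ suc (m ℕ.+ g) → Maximum M m → Val N n M (λ _ → ⊥) (b g ⊕ seen M m ⊛ h g)
  head zero    n g n≡ max = valued-zero
  head (suc N) n {M} {m} g n≡ max = ascending-suc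
    (λ j → b (g ∸ j) ⊕ (W ⊕ (# 1 ⊕ # j ⊛ t)) ⊛ h (g ∸ j)) n≡ max
    (Sums-tabulate m (λ u → weight (M u) ⊛ (c ⊛ G)) λ u u<m →
      enter {F′ = u ≢_} id (λ _ → refl)
        (λ w → mk⇔ (λ u≢w → now m (max .attained) u<m u≢w tt) (λ { (before ()) ; (now _ _ _ u≢w _) → u≢w }))
        (stay N (suc n) u (s≤s (ℕₚ.≤-trans (ℕₚ.<⇒≤ u<m) m≤n)) (∪-self M u)
          (λ w → λ { (before u≢w) → u≢w ; (now _ _ _ u≢w _) → u≢w })))
    (λ n≡′ → head N (suc n) (suc g) n≡′ max)
    (λ j n≡′ → valued-≃ (⊕-congˡ (b (g ∸ j)) (⊛-congʳ (h (g ∸ j)) (seen-above max j)))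
      (head N (suc n) (g ∸ j) n≡′ (raise max (s≤s (ℕₚ.m≤m+n m j)))))
    (≃-trans (modulo₂ (⊝ # 1) (⊝ W) (≃⇒⊝≃0 (zt-Y g)) (≃⇒⊝≃0 (zt-U g))
      (solve 11 (λ c z t k b₀ b₁ h₀ h₁ W Y U →
        b₀ :+ W :* h₀ := c :+ z :* (W :* (c :* k) :+ (b₁ :+ W :* h₁) :+ t :* (Y :+ W :* U))
          :+ (:- 1′) :* (z :* t :* Y :- (b₀ :- c :- z :* b₁))
          :+ (:- W) :* (z :* t :* U :- (h₀ :- z :* c :* k :- z :* h₁)))
        ≃-refl c z t G (b g) (b (suc g)) (h g) (h (suc g)) W (Y g) (U g)))
      (⊕-congˡ c (⊛-congˡ z (⊕-cong (⊕-congʳ (b (suc g) ⊕ W ⊛ h (suc g)) Σ-below) Σ-above))))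
    where
    W : Series
    W = seen M m
    m≤n : m ≤ n
    m≤n = subst (m ≤_) (sym n≡) (ℕₚ.m≤n⇒m≤1+n (ℕₚ.m≤m+n m g))
    Σ-below : W ⊛ (c ⊛ G) ≃ Σ< m (λ u → weight (M u) ⊛ (c ⊛ G))
    Σ-below = ≃-trans (solve 2 (λ a b → a :* b := b :* a) ≃-refl W (c ⊛ G)) (≃-trans
      (Σ<-⊛ (c ⊛ G) m (λ u → weight (M u)))
      (Σ<-cong m λ u _ → solve 2 (λ a b → a :* b := b :* a) ≃-refl (c ⊛ G) (weight (M u))))
    Σ-above : t ⊛ (Y g ⊕ W ⊛ U g) ≃ Σ< (suc g) (λ j → t ⊛ (b (g ∸ j) ⊕ (W ⊕ (# 1 ⊕ # j ⊛ t)) ⊛ h (g ∸ j)))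
    Σ-above = ≃-trans (⊛-congˡ t (≃-trans (⊕-congˡ (Y g) (Σ<-⊛ W (suc g) (λ j → h (g ∸ j))))
        (≃-sym (Σ<-⊕ (suc g) (λ j → b (g ∸ j) ⊕ (# 1 ⊕ # j ⊛ t) ⊛ h (g ∸ j)) (λ j → W ⊛ h (g ∸ j))))))
      (≃-trans (Σ<-⊛ t (suc g) (λ j → b (g ∸ j) ⊕ (# 1 ⊕ # j ⊛ t) ⊛ h (g ∸ j) ⊕ W ⊛ h (g ∸ j)))
      (Σ<-cong (suc g) λ j _ → solve 5 (λ t x y W h → t :* (x :+ y :* h :+ W :* h) := t :* (x :+ (W :+ y) :* h))
        ≃-refl t (b (g ∸ j)) (# 1 ⊕ # j ⊛ t) W (h (g ∸ j))))

  counted : c ⊛ Igf >r ≠r -r ≃ c ⊕ z ⊛ (t ⊛ (b 0 ⊕ # 0 ⊛ h 0))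
  counted = from-one (λ N → head N 1 0 refl maximum-only-zero)

  result : ∃ λ S →
    (S 0 0 ≡ + 1)
    × (S ⊛ S ≋ (# 1 ⊕ z ⊝ z ⊛ t) ^ₛ 2 ⊝ # 4 ⊛ z)
    × (# 2 ⊛ (# 1 ⊝ z) ⊛ S ⊛ Igf >r ≠r -r
         ≋ # 1 ⊝ # 2 ⊛ z ⊕ z ^ₛ 2 ⊛ (# 1 ⊝ t) ^ₛ 2 ⊕ (# 1 ⊝ z ⊕ z ⊛ t) ⊛ S)
  result = discriminant , refl
    , at (≃-trans discriminant² (solve 2 (λ z t →
        (1′ :+ z :- z :* t) ^′ 2 :- 4′ :* z :* 1′ := (1′ :+ z :- z :* t) ^′ 2 :- 4′ :* z) ≃-refl z t))
    , at (≃-trans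
        (solve 3 (λ z s i → 2′ :* (1′ :- z) :* s :* i := 2′ :* (1′ :- z) :* (s :* i)) ≃-refl z c (Igf >r ≠r -r))
        (≃-trans (⊛-congˡ (# 2 ⊛ (# 1 ⊝ z)) counted)
        -- `H` enters squared: the relation 1 - H (1 - z λ), multiplied by 1 + H (1 - z λ), becomes
        -- 1 - H² (1 - z λ)².
        (modulo₃ (H ⊛ H ⊛ K) (A ⊛ (# 1 ⊕ H ⊛ (# 1 ⊝ z ⊛ root))) (# 2 ⊛ (z ⊛ t ⊛ c ⊕ z ^ₛ 2 ⊛ t ^ₛ 2 ⊛ H ⊛ H))
          root-eq H-eq G-inverse
          (solve 5 (λ z t g l h →
            let S = c′ z t l
                rhs = 1′ :- 2′ :* z :+ z ^′ 2 :* (1′ :- t) ^′ 2 :+ (1′ :- z :+ z :* t) :* S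
                A = 2′ :* (1′ :- z) :* S :+ 2′ :* z :* t :* S :- rhs
                K = 2′ :* z :- 2′ :* z ^′ 2 :+ 4′ :* z ^′ 2 :* t :+ (2′ :* z ^′ 3 :- 2′ :* z ^′ 3 :* t :- 2′ :* z ^′ 2) :* l
            in 2′ :* (1′ :- z) :* (S :+ z :* (t :* (b′ z t g l h (con (+ 0)) 1′ :+ con (+ 0) :* h′ z t g l h (l :* 1′))))
               := rhs :+ h :* h :* K :* root′ z t l :+ A :* (1′ :+ h :* (1′ :- z :* l)) :* H′ z l h
                  :+ 2′ :* (z :* t :* S :+ z ^′ 2 :* t ^′ 2 :* h :* h) :* ((1′ :- z) :* g :- 1′)) ≃-refl z t G root H))))
    where
    A K : Series
    A = # 2 ⊛ (# 1 ⊝ z) ⊛ c ⊕ # 2 ⊛ z ⊛ t ⊛ c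
      ⊝ (# 1 ⊝ # 2 ⊛ z ⊕ z ^ₛ 2 ⊛ (# 1 ⊝ t) ^ₛ 2 ⊕ (# 1 ⊝ z ⊕ z ⊛ t) ⊛ c)
    K = # 2 ⊛ z ⊝ # 2 ⊛ z ^ₛ 2 ⊕ # 4 ⊛ z ^ₛ 2 ⊛ t ⊕ (# 2 ⊛ z ^ₛ 3 ⊝ # 2 ⊛ z ^ₛ 3 ⊛ t ⊝ # 2 ⊛ z ^ₛ 2) ⊛ root

theorem5p4 : ((# 1 ⊝ z) ^ₛ 3 ⊛ Igf <r -r <r
    ≋ # 1 ⊝ # 3 ⊛ z ⊕ z ⊛ t ⊕ # 3 ⊛ z ^ₛ 2 ⊝ # 2 ⊛ z ^ₛ 2 ⊛ t ⊕ z ^ₛ 2 ⊛ t ^ₛ 2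
    ⊝ z ^ₛ 3 ⊕ z ^ₛ 3 ⊛ t)
    × ((# 1 ⊝ z) ^ₛ 2 ⊛ (# 1 ⊝ # 2 ⊛ z ⊕ z ^ₛ 2 ⊝ z ^ₛ 2 ⊛ t) ⊛ Igf ≠r <r -r
    ≋ # 1 ⊝ # 4 ⊛ z ⊕ z ⊛ t ⊕ # 6 ⊛ z ^ₛ 2 ⊝ # 4 ⊛ z ^ₛ 2 ⊛ t ⊕ z ^ₛ 2 ⊛ t ^ₛ 2
    ⊝ # 4 ⊛ z ^ₛ 3 ⊕ # 5 ⊛ z ^ₛ 3 ⊛ t ⊝ z ^ₛ 3 ⊛ t ^ₛ 2
    ⊕ z ^ₛ 4 ⊝ # 2 ⊛ z ^ₛ 4 ⊛ t ⊕ z ^ₛ 4 ⊛ t ^ₛ 2)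
    × ((# 1 ⊝ z) ⊛ (# 1 ⊝ z ⊝ z ^ₛ 2 ⊛ t) ⊛ Igf ≠r ≤r -r
    ≋ # 1 ⊝ # 2 ⊛ z ⊕ z ⊛ t ⊕ z ^ₛ 2 ⊝ # 2 ⊛ z ^ₛ 2 ⊛ t ⊕ z ^ₛ 2 ⊛ t ^ₛ 2
    ⊕ z ^ₛ 3 ⊛ t)
    × (∃ λ G → ∃ λ S →
    ((# 1 ⊝ z) ⊛ G ≋ # 1)
    × (S 0 0 ≡ + 1)
    × (S ⊛ S ≋ (# 1 ⊕ z ⊝ z ⊛ t) ^ₛ 2 ⊝ # 4 ⊛ z ⊛ (# 1 ⊝ z ⊕ z ⊛ t) ⊛ G)
    × (# 2 ⊛ z ⊛ (# 2 ⊝ z) ⊛ Igf >r <r -r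
    ≋ # 1 ⊕ z ⊛ (# 2 ⊝ t) ⊝ z ^ₛ 2 ⊛ (# 1 ⊝ t) ⊝ (# 1 ⊝ z) ⊛ S))
    × (∃ λ S →
    (S 0 0 ≡ + 1)
    × (S ⊛ S ≋ # 1 ⊝ z ⊛ (# 2 ⊕ # 2 ⊛ t ⊝ z ⊕ # 6 ⊛ z ⊛ t ⊝ z ⊛ t ^ₛ 2))
    × (# 4 ⊛ z ⊛ Igf >r ≤r -r ≋ # 1 ⊕ z ⊛ (# 3 ⊝ t) ⊝ S))
    × (∃ λ S →
    (S 0 0 ≡ + 1)
    × (S ⊛ S ≋ (# 1 ⊕ z ⊝ z ⊛ t) ^ₛ 2 ⊝ # 4 ⊛ z)
    × (# 2 ⊛ (# 1 ⊝ z) ⊛ S ⊛ Igf >r ≠r -r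
    ≋ # 1 ⊝ # 2 ⊛ z ⊕ z ^ₛ 2 ⊛ (# 1 ⊝ t) ^ₛ 2 ⊕ (# 1 ⊝ z ⊕ z ⊛ t) ⊛ S))
    × ((# 1 ⊝ z) ⊛ (# 1 ⊝ z ⊛ t) ^ₛ 2 ⊛ Igf ≥r ≠r -r
    ≋ # 1 ⊝ z ⊝ z ⊛ t ⊕ # 2 ⊛ z ^ₛ 2 ⊛ t)
    × ((# 1 ⊝ z ⊝ z ⊛ t) ⊛ Igf =r <r -r ≋ # 1 ⊝ z)
    × ((# 1 ⊝ z ⊛ t ⊝ z ^ₛ 2 ⊛ t) ⊛ Igf =r ≤r -r ≋ # 1)
    × ((# 1 ⊝ z) ⊛ (# 1 ⊝ z ⊛ t ⊝ z ^ₛ 2 ⊛ t) ⊛ Igf ≥r ≤r ≠r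
    ≋ # 1 ⊝ z ⊕ z ^ₛ 3 ⊛ t)
theorem5p4 =
  at <---< , at ≠-< , at ≠-≤ , >-< , >-≤ , AscendingConstant.result , at ≥-≠ , at =-< , at =-≤ , at ≥-≤-≠
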